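{- Let $\mathcal{Q}$ be an admissible quantifier prefix and let $\mathcal{Q}\varphi$ be a state formula of $\mathcal{L}_{\mathrm{HDMAS}}$. Then $\mathsf{push}(\mathcal{Q},\varphi)\equiv_{fin}\mathcal{Q}\varphi$.
   Context: HDMAS models: $\mathcal{M}=\langle\mathit{Ag},\mathit{Act}^+,S,d,\delta,\mathit{AP},\lambda\rangle$ with states $S$, actions $\mathit{Act}^+=\{act_1,\dots,act_n,\varepsilon\}$, available actions $d(s)\ni\varepsilon$, and transitions determined by quantifier-free Presburger guards $\delta(s,s')$ over the numbers $x_i$ of agents performing $act_i$ (each vector of counts over the available actions satisfies exactly one outgoing guard); $\lambda:S\to\mathcal{P}(\mathit{AP})$. An abstract joint strategy for $C$ agents assigns to each state a distribution of $C$ agents over its available actions. $\mathcal{M},s,\theta\models\langle\langle t_1,t_2\rangle\rangle\chi$ iff some abstract joint strategy for $\theta(t_1)$ agents guarantees that every play from $s$ (where at each state the successor is determined by the sum of the strategy's distribution and an arbitrary distribution of $\theta(t_2)$ further agents over the available actions) satisfies $\chi$, with $\mathsf{X},\mathsf{G},\mathsf{U}$ standard along plays; $p$ true iff $p\in\lambda(s)$; Booleans standard; quantifiers range over $\mathbb{N}$. Syntax: terms $T=\{y_1,y_2\}\cup\{z_1,z_2,\dots\}\cup\mathbb{N}$; assignments $\theta:T\to\mathbb{N}$ fixing numerals. Path formulas: $\mathsf{X}\varphi$, $\mathsf{G}\varphi$, $\psi\,\mathsf{U}\,\varphi$. State formulas: $\varphi::=\top\mid p\mid\neg\varphi\mid\varphi\wedge\varphi\mid\varphi\vee\varphi\mid\langle\langle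 t_1,t_2\rangle\rangle\chi\mid\mathcal{Q}\varphi$, $t_1\in T\setminus\{y_2\}$, $t_2\in T\setminus\{y_1\}$, where an admissible quantifier prefix $\mathcal{Q}$ is a string $\mathsf{Q}y_i$ or $\mathsf{Q}y_i\mathsf{Q}'y_j$ ($\mathsf{Q},\mathsf{Q}'\in\{\forall,\exists\}$, $i\neq j\in\{1,2\}$), and all free occurrences in $\varphi$ of variables quantified by $\mathcal{Q}$ must be positive (in the scope of an even number of negations). $\varphi\equiv_{fin}\psi$ means $\mathcal{M},s,\theta\models\varphi$ iff $\mathcal{M},s,\theta\models\psi$ for every HDMAS $\mathcal{M}$ with finite state space, state $s$ and assignment $\theta$. The function $\mathsf{push}(\mathcal{Q},\xi)$ ($\mathcal{Q}$ admissible prefix, $\xi$ a state or path formula; $\overline{\mathcal{Q}}$ is $\mathcal{Q}$ with each quantifier replaced by its dual): $\mathsf{push}(\mathcal{Q},\top)=\top$, $\mathsf{push}(\mathcal{Q},p)=p$; $\mathsf{push}(\mathcal{Q},\neg\psi)=\neg\mathsf{push}(\overline{\mathcal{Q}},\psi)$; $\mathsf{push}$ distributes over $\wedge,\vee$, and $\mathsf{push}(\mathcal{Q},\mathsf{X}\psi)=\mathsf{X}\,\mathsf{push}(\mathcal{Q},\psi)$, likewise for $\mathsf{G}$, and $\mathsf{push}(\mathcal{Q},\psi_1\mathsf{U}\psi_2)=\mathsf{push}(\mathcal{Q},\psi_1)\,\mathsf{U}\,\mathsf{push}(\mathcal{Q},\psi_2)$. For $\xi=\langle\langle t_1,t_2\rangle\rangle\chi$: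 if $\mathcal{Q}=\mathsf{Q}y_i$ with $t_i=y_i$, or $\mathcal{Q}$ is $\mathsf{Q}y_1\mathsf{Q}'y_2$ or $\mathsf{Q}'y_2\mathsf{Q}y_1$ with $t_1=y_1$ and $t_2=y_2$, return $\mathcal{Q}\langle\langle t_1,t_2\rangle\rangle\mathsf{push}(\mathcal{Q},\chi)$; if $\mathcal{Q}=\mathsf{Q}y_i$ with $t_i\ne y_i$, or $\mathcal{Q}$ is $\mathsf{Q}y_1\mathsf{Q}'y_2$ or $\mathsf{Q}'y_2\mathsf{Q}y_1$ with $t_1\ne y_1$, $t_2\ne y_2$, return $\langle\langle t_1,t_2\rangle\rangle\mathsf{push}(\mathcal{Q},\chi)$; if $\mathcal{Q}$ is $\mathsf{Q}y_1\mathsf{Q}'y_2$ or $\mathsf{Q}'y_2\mathsf{Q}y_1$ with $t_1=y_1$, $t_2\neq y_2$, return $\mathsf{Q}y_1\langle\langle t_1,t_2\rangle\rangle\mathsf{push}(\mathcal{Q},\chi)$; if instead $t_1\neq y_1$, $t_2=y_2$, return $\mathsf{Q}'y_2\langle\langle t_1,t_2\rangle\rangle\mathsf{push}(\mathcal{Q},\chi)$. For $\xi=\mathsf{Q}''y_k\psi$: if $\mathcal{Q}=\mathsf{Q}y_i$ with $i=k$, return $\mathsf{push}(\mathsf{Q}''y_k,\psi)$; if $\mathcal{Q}=\mathsf{Q}y_i$ with $i\ne k$, return $\mathsf{push}(\mathsf{Q}y_i\mathsf{Q}''y_k,\psi)$; if $\mathcal{Q}=\mathsf{Q}y_i\mathsf{Q}'y_j$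 with $i=k$, return $\mathsf{push}(\mathsf{Q}'y_j\mathsf{Q}''y_k,\psi)$; if $\mathcal{Q}=\mathsf{Q}y_i\mathsf{Q}'y_j$ with $j=k$, return $\mathsf{push}(\mathsf{Q}y_i\mathsf{Q}''y_k,\psi)$. -}

module Defs where

open import Data.Nat using (ℕ; zero; suc; _+_; _*_; _≤ᵇ_; _≡ᵇ_; _%_; _<_)
open import Data.Bool using (Bool; true; false; not; _∧_; _∨_; T; if_then_else_)
open import Data.Fin using (Fin; zero; suc)
open import Data.Product using (Σ; _×_; _,_; proj₁)
open import Data.Sum using (_⊎_)
open import Data.Unit using (⊤)
open import Relation.Nullary using (¬_)
open import Relation.Binary.PropositionalEquality using (_≡_; _≢_)
open import Relation.Unary using (Pred)
open import Level using (0ℓ)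

data PTerm (n : ℕ) : Set where
  pconst : ℕ → PTerm n
  pvar   : Fin n → PTerm n
  _⊕_    : PTerm n → PTerm n → PTerm n
  _⊛_    : ℕ → PTerm n → PTerm n

data Guard (n : ℕ) : Set where
  gtrue gfalse : Guard n
  _≤g_ _≐g_    : PTerm n → PTerm n → Guard n
  congr        : ℕ → PTerm n → PTerm n → Guard n   -- congr k t t' : t ≡ t' (mod (k+1))
  gnot         : Guard n → Guard n
  gand gor     : Guard n → Guard n → Guard n

evalT : ∀ {n} → PTerm n → (Fin n → ℕ) → ℕ
evalT (pconst k) x = k
evalT (pvar i)   x = x i
evalT (t ⊕ u)    x = evalT t x + evalT u x
evalT (k ⊛ t)    x = k * evalT t x

evalG : ∀ {n} → Guard n → (Fin n → ℕ) → Bool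
evalG gtrue        x = true
evalG gfalse       x = false
evalG (t ≤g u)     x = evalT t x ≤ᵇ evalT u x
evalG (t ≐g u)     x = evalT t x ≡ᵇ evalT u x
evalG (congr k t u) x = (evalT t x % suc k) ≡ᵇ (evalT u x % suc k)
evalG (gnot g)     x = not (evalG g x)
evalG (gand g h)   x = evalG g x ∧ evalG h x
evalG (gor g h)    x = evalG g x ∨ evalG h x

sumF : ∀ {k} → (Fin k → ℕ) → ℕ
sumF {zero}  f = 0
sumF {suc k} f = f zero + sumF (λ i → f (suc i))

-- HDMAS models with FINITE state space (states = Fin nSt).
-- Actions Act⁺ = Fin (suc nAct): zero is ε, suc i is act_(i+1).

record HDMAS (AP : Set) : Set₁ where
  field
    nAct : ℕ
    nSt  : ℕ
    d    : Fin nSt → Fin (suc nAct) → Bool            -- available actions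
    d-ε  : ∀ s → d s zero ≡ true
    δ    : Fin nSt → Fin nSt → Guard nAct
    lab  : Fin nSt → Pred AP 0ℓ
    δ-det : ∀ s (c : Fin nAct → ℕ) → (∀ i → d s (suc i) ≡ false → c i ≡ 0) →
            Σ (Fin nSt) λ s' → T (evalG (δ s s') c) ×
              (∀ s'' → T (evalG (δ s s'') c) → s'' ≡ s')

  State : Set
  State = Fin nSt

  Act : Set
  Act = Fin (suc nAct)

  Dist : State → ℕ → Set
  Dist s C = Σ (Act → ℕ) λ f → (sumF f ≡ C) × (∀ a → d s a ≡ false → f a ≡ 0)

  Strategy : ℕ → Set
  Strategy C = (s : State) → Dist s C

  Next : State → (Act → ℕ) → State → Set
  Next s f s' = T (evalG (δ s s') (λ i → f (suc i)))

  IsPlay : ∀ {C1} → Strategy C1 → ℕ → State → (ℕ → State) → Set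
  IsPlay σ C2 s ρ = (ρ 0 ≡ s) ×
    (∀ k → Σ (Dist (ρ k) C2) λ τ →
       Next (ρ k) (λ a → proj₁ (σ (ρ k)) a + proj₁ τ a) (ρ (suc k)))

data YVar : Set where
  𝕪₁ 𝕪₂ : YVar

other : YVar → YVar
other 𝕪₁ = 𝕪₂
other 𝕪₂ = 𝕪₁

data Term : Set where
  y₁ y₂ : Term
  z     : ℕ → Term
  num   : ℕ → Term

yT : YVar → Term
yT 𝕪₁ = y₁
yT 𝕪₂ = y₂

data Quant : Set where
  ∀q ∃q : Quant

dualQ : Quant → Quant
dualQ ∀q = ∃q
dualQ ∃q = ∀q

mutual
  data SF (AP : Set) : Set where
    ⊤f      : SF AP
    prop    : AP → SF AP
    ¬f      : SF AP → SF AP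
    _∧f_    : SF AP → SF AP → SF AP
    _∨f_    : SF AP → SF AP → SF AP
    ⟪_,_⟫_  : Term → Term → PF AP → SF AP
    Qf      : Quant → YVar → SF AP → SF AP

  data PF (AP : Set) : Set where
    Xf : SF AP → PF AP
    Gf : SF AP → PF AP
    _Uf_ : SF AP → SF AP → PF AP

-- admissible quantifier prefixes:  one Q i = Q y_i ;  two Q i Q' = Q y_i Q' y_j  with j = other i
data Prefix : Set where
  one : Quant → YVar → Prefix
  two : Quant → YVar → Quant → Prefix

dualP : Prefix → Prefix
dualP (one q i)    = one (dualQ q) i
dualP (two q i q') = two (dualQ q) i (dualQ q')

applyP : ∀ {AP} → Prefix → SF AP → SF AP
applyP (one q i)    φ = Qf q i φ
applyP (two q i q') φ = Qf q i (Qf q' (other i) φ)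

sameY : YVar → YVar → Bool
sameY 𝕪₁ 𝕪₁ = true
sameY 𝕪₂ 𝕪₂ = true
sameY _  _  = false

occT : YVar → Term → Bool
occT 𝕪₁ y₁ = true
occT 𝕪₂ y₂ = true
occT _  _  = false

-- negOcc i pol φ : does y_i occur free in φ under an odd number of negations
-- (pol = true means the current position is positive)
mutual
  negOcc : ∀ {AP} → YVar → Bool → SF AP → Bool
  negOcc i pol ⊤f = false
  negOcc i pol (prop p) = false
  negOcc i pol (¬f φ) = negOcc i (not pol) φ
  negOcc i pol (φ ∧f ψ) = negOcc i pol φ ∨ negOcc i pol ψ
  negOcc i pol (φ ∨f ψ) = negOcc i pol φ ∨ negOcc i pol ψ
  negOcc i pol (⟪ t₁ , t₂ ⟫ χ) = (not pol ∧ (occT i t₁ ∨ occT i t₂)) ∨ negOccP i pol χ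
  negOcc i pol (Qf q j φ) = if sameY i j then false else negOcc i pol φ

  negOccP : ∀ {AP} → YVar → Bool → PF AP → Bool
  negOccP i pol (Xf φ) = negOcc i pol φ
  negOccP i pol (Gf φ) = negOcc i pol φ
  negOccP i pol (φ Uf ψ) = negOcc i pol φ ∨ negOcc i pol ψ

mutual
  WF : ∀ {AP} → SF AP → Set
  WF ⊤f = ⊤
  WF (prop p) = ⊤
  WF (¬f φ) = WF φ
  WF (φ ∧f ψ) = WF φ × WF ψ
  WF (φ ∨f ψ) = WF φ × WF ψ
  WF (⟪ t₁ , t₂ ⟫ χ) = (t₁ ≢ y₂) × (t₂ ≢ y₁) × WFP χ
  WF (Qf q i φ) = (negOcc i true φ ≡ false) × WF φ

  WFP : ∀ {AP} → PF AP → Set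
  WFP (Xf φ) = WF φ
  WFP (Gf φ) = WF φ
  WFP (φ Uf ψ) = WF φ × WF ψ

isY1 : Term → Bool
isY1 y₁ = true
isY1 _  = false

isY2 : Term → Bool
isY2 y₂ = true
isY2 _  = false

q₁of q₂of : Quant → YVar → Quant → Quant
q₁of q 𝕪₁ q' = q
q₁of q 𝕪₂ q' = q'
q₂of q 𝕪₁ q' = q'
q₂of q 𝕪₂ q' = q

pushCoal : ∀ {AP} → Prefix → Term → Term → PF AP → SF AP
pushCoal (one q 𝕪₁) t₁ t₂ χ =
  if isY1 t₁ then Qf q 𝕪₁ (⟪ t₁ , t₂ ⟫ χ) else ⟪ t₁ , t₂ ⟫ χ
pushCoal (one q 𝕪₂) t₁ t₂ χ =
  if isY2 t₂ then Qf q 𝕪₂ (⟪ t₁ , t₂ ⟫ χ) else ⟪ t₁ , t₂ ⟫ χ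
pushCoal (two q i q') t₁ t₂ χ with isY1 t₁ | isY2 t₂
... | true  | true  = applyP (two q i q') (⟪ t₁ , t₂ ⟫ χ)
... | false | false = ⟪ t₁ , t₂ ⟫ χ
... | true  | false = Qf (q₁of q i q') 𝕪₁ (⟪ t₁ , t₂ ⟫ χ)
... | false | true  = Qf (q₂of q i q') 𝕪₂ (⟪ t₁ , t₂ ⟫ χ)

newPrefix : Prefix → Quant → YVar → Prefix
newPrefix (one q i)    q'' k = if sameY i k then one q'' k else two q i q''
newPrefix (two q i q') q'' k = if sameY i k then two q' (other i) q'' else two q i q''

mutual
  push : ∀ {AP} → Prefix → SF AP → SF AP
  push 𝒬 ⊤f = ⊤f
  push 𝒬 (prop p) = prop p
  push 𝒬 (¬f ψ) = ¬f (push (dualP 𝒬) ψ)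
  push 𝒬 (φ ∧f ψ) = push 𝒬 φ ∧f push 𝒬 ψ
  push 𝒬 (φ ∨f ψ) = push 𝒬 φ ∨f push 𝒬 ψ
  push 𝒬 (⟪ t₁ , t₂ ⟫ χ) = pushCoal 𝒬 t₁ t₂ (pushP 𝒬 χ)
  push 𝒬 (Qf q'' k ψ) = push (newPrefix 𝒬 q'' k) ψ

  pushP : ∀ {AP} → Prefix → PF AP → PF AP
  pushP 𝒬 (Xf φ) = Xf (push 𝒬 φ)
  pushP 𝒬 (Gf φ) = Gf (push 𝒬 φ)
  pushP 𝒬 (φ Uf ψ) = push 𝒬 φ Uf push 𝒬 ψ

-- Assignments θ : T → ℕ fixing numerals (given by values of y₁, y₂, z_k)

record Asg : Set where
  field
    yv : YVar → ℕ
    zv : ℕ → ℕ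

⟦_⟧_ : Term → Asg → ℕ
⟦ y₁ ⟧ θ = Asg.yv θ 𝕪₁
⟦ y₂ ⟧ θ = Asg.yv θ 𝕪₂
⟦ z k ⟧ θ = Asg.zv θ k
⟦ num k ⟧ θ = k

_[_↦_] : Asg → YVar → ℕ → Asg
θ [ i ↦ n ] = record { yv = λ j → if sameY i j then n else Asg.yv θ j ; zv = Asg.zv θ }

module _ {AP : Set} (M : HDMAS AP) where
  open HDMAS M

  mutual
    Sat : State → Asg → SF AP → Set
    Sat s θ ⊤f = ⊤
    Sat s θ (prop p) = lab s p
    Sat s θ (¬f φ) = ¬ Sat s θ φ
    Sat s θ (φ ∧f ψ) = Sat s θ φ × Sat s θ ψ
    Sat s θ (φ ∨f ψ) = Sat s θ φ ⊎ Sat s θ ψ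
    Sat s θ (⟪ t₁ , t₂ ⟫ χ) =
      Σ (Strategy (⟦ t₁ ⟧ θ)) λ σ →
        ∀ (ρ : ℕ → State) → IsPlay σ (⟦ t₂ ⟧ θ) s ρ → SatP ρ θ χ
    Sat s θ (Qf ∀q i φ) = ∀ (n : ℕ) → Sat s (θ [ i ↦ n ]) φ
    Sat s θ (Qf ∃q i φ) = Σ ℕ λ n → Sat s (θ [ i ↦ n ]) φ

    SatP : (ℕ → State) → Asg → PF AP → Set
    SatP ρ θ (Xf φ) = Sat (ρ 1) θ φ
    SatP ρ θ (Gf φ) = ∀ k → Sat (ρ k) θ φ
    SatP ρ θ (φ Uf ψ) = Σ ℕ λ k → Sat (ρ k) θ ψ × (∀ j → j < k → Sat (ρ j) θ φ)

{-# OPTIONS --safe #-}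

-- Since idle agents do not enter the guards, a positive formula is monotone: upwards in y₁ and
-- downwards in y₂. A quantifier over a monotone predicate only looks at its limit value, at 0 or at
-- infinity, and taking a limit commutes with negation, disjunction and the temporal operators, so
-- pushing a prefix inwards amounts to evaluating all coalition formulas at the same limit point.
--
-- Constructively one needs to know where a coalition formula becomes constant. With finitely many
-- states, its truth depends only on which sets of successors can be forced at each state; these
-- conditions are Presburger definable in the numbers of agents, so quantifier elimination (Cooper's
-- method over ℕ) decides whether and where they change.
module Submission where

open import Defs
open import Data.Bool using (Bool; true; false; not; _∧_; _∨_; T; if_then_else_)
open import Data.Bool.Properties as Bool using (T?; T-∧; T-∨)
open import Data.Empty using (⊥-elim)
open import Data.Fin using (Fin; zero; suc; _↑ˡ_; _↑ʳ_)
open import Data.Integer as ℤ using (ℤ; +_; -[1+_])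
import Data.Integer.Properties as ℤ
open import Data.Integer.Divisibility.Signed as ℤ∣ using (divides) renaming (_∣_ to _∣ℤ_; _∣?_ to _∣ℤ?_)
open import Data.Integer.Tactic.RingSolver using (solve-∀)
open import Data.List as List using (List; []; _∷_)
open import Data.List.Relation.Unary.Any as Any using (Any; here; there; satisfied)
open import Data.List.Relation.Unary.Any.Properties using (++⁺ˡ; ++⁺ʳ)
open import Data.Nat as ℕ using (ℕ; zero; suc; _+_; _*_; _∸_; _≤_; _<_; z≤n; s≤s)
open import Data.Nat.Divisibility using (_∣_; ∣-refl; ∣-trans; m∣m*n; n∣m*n)
import Data.Nat.DivMod as ℕ
open import Data.Nat.Induction using (<-rec)
import Data.Nat.Properties as ℕ
open import Data.Product using (Σ; _×_; _,_; proj₁; proj₂; map₂)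
open import Data.Product.Function.NonDependent.Propositional using (_×-⇔_)
open import Data.Sum.Function.Propositional using (_⊎-⇔_)
open import Data.Sum using (_⊎_; inj₁; inj₂; [_,_]′) renaming (map to map-⊎)
open import Data.Unit using (⊤; tt)
open import Data.Vec as Vec using (Vec; []; _∷_; lookup; tabulate)
import Data.Vec.Properties as Vec
open import Function using (_∘_; id; case_of_)
open import Function.Bundles using (_⇔_; mk⇔; Equivalence)
open import Function.Properties.Equivalence using () renaming (refl to ⇔-refl; sym to ⇔-sym; trans to ⇔-trans)
open import Relation.Nullary using (¬_; Dec; yes; no; contradiction)
open import Relation.Nullary.Decidable using (¬?; decidable-stable; ⌊_⌋; fromWitness; toWitness; _×-dec_; _⊎-dec_) renaming (map to map-dec)
open import Relation.Binary.PropositionalEquality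

open Equivalence using (to; from)

-- Two obstacles shape the proof. First, `G` and `U` inspect infinitely many positions of a play, so
-- one threshold has to serve all states; hence equivalences carry `∀ s` inside the limit. A
-- coalition formula, which ranges over strategies and infinite plays, is itself never decided:
-- `CoalBy` splits it into a choice of target sets, finitely many one-step conditions on the numbers
-- of agents, and a winning condition free of these numbers. Second, the theorem is no induction
-- hypothesis: a quantifier need not commute with a connective when the operands are arbitrary, and
-- the prefix changes below binders and negations. The induction `push-limit` shows instead that a
-- formula near the limit agrees with its pushed form at the original assignment. This is
-- compositional, and `collapse` turns it back into a statement about quantifiers.

-- Quantifier elimination

infixr 5 _▸_
infixl 6 _⊞_
infixr 7 _⊡_

data Lin : ℕ → Set where
  const : ℤ → Lin 0
  _▸_   : ∀ {k} → ℤ → Lin k → Lin (suc k)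

evalL : ∀ {k} → Lin k → Vec ℕ k → ℤ
evalL (const c) []      = c
evalL (a ▸ t)   (x ∷ ρ) = a ℤ.* + x ℤ.+ evalL t ρ

constL : ∀ {k} → ℤ → Lin k
constL {zero}  c = const c
constL {suc k} c = + 0 ▸ constL c

varL : ∀ {k} → Fin k → Lin k
varL zero    = + 1 ▸ constL (+ 0)
varL (suc i) = + 0 ▸ varL i

_⊞_ : ∀ {k} → Lin k → Lin k → Lin k
const c ⊞ const d = const (c ℤ.+ d)
(a ▸ t) ⊞ (b ▸ u) = (a ℤ.+ b) ▸ (t ⊞ u)

_⊡_ : ∀ {k} → ℤ → Lin k → Lin k
c ⊡ const d = const (c ℤ.* d)
c ⊡ (a ▸ t) = (c ℤ.* a) ▸ (c ⊡ t)

evalL-const : ∀ {k} c (ρ : Vec ℕ k) → evalL (constL c) ρ ≡ c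
evalL-const c []      = refl
evalL-const c (x ∷ ρ) = trans (ℤ.+-identityˡ _) (evalL-const c ρ)

evalL-var : ∀ {k} i (ρ : Vec ℕ k) → evalL (varL i) ρ ≡ + lookup ρ i
evalL-var zero    (x ∷ ρ) =
  trans (cong₂ ℤ._+_ (ℤ.*-identityˡ (+ x)) (evalL-const (+ 0) ρ)) (ℤ.+-identityʳ (+ x))
evalL-var (suc i) (x ∷ ρ) = trans (ℤ.+-identityˡ _) (evalL-var i ρ)

evalL-⊞ : ∀ {k} t u (ρ : Vec ℕ k) → evalL (t ⊞ u) ρ ≡ evalL t ρ ℤ.+ evalL u ρ
evalL-⊞ (const c) (const d) []      = refl
evalL-⊞ (a ▸ t)   (b ▸ u)   (x ∷ ρ) =
  trans (cong (λ v → (a ℤ.+ b) ℤ.* + x ℤ.+ v) (evalL-⊞ t u ρ)) (rearrange a b (+ x) _ _)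
  where
  rearrange : ∀ a b x t u → (a ℤ.+ b) ℤ.* x ℤ.+ (t ℤ.+ u) ≡ a ℤ.* x ℤ.+ t ℤ.+ (b ℤ.* x ℤ.+ u)
  rearrange = solve-∀

evalL-⊡ : ∀ {k} c t (ρ : Vec ℕ k) → evalL (c ⊡ t) ρ ≡ c ℤ.* evalL t ρ
evalL-⊡ c (const d) []      = refl
evalL-⊡ c (a ▸ t)   (x ∷ ρ) =
  trans (cong (λ v → c ℤ.* a ℤ.* + x ℤ.+ v) (evalL-⊡ c t ρ)) (rearrange c a (+ x) _)
  where
  rearrange : ∀ c a x t → c ℤ.* a ℤ.* x ℤ.+ c ℤ.* t ≡ c ℤ.* (a ℤ.* x ℤ.+ t)
  rearrange = solve-∀

-- div d b t asserts that suc d divides t exactly when b is true.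
data QF (k : ℕ) : Set where
  positive : Lin k → QF k
  div      : ℕ → Bool → Lin k → QF k
  and or   : QF k → QF k → QF k

Holds : Bool → Set → Set
Holds true  A = A
Holds false A = ¬ A

⟦_⟧Q : ∀ {k} → QF k → Vec ℕ k → Set
⟦ positive t ⟧Q ρ = + 0 ℤ.< evalL t ρ
⟦ div d b t ⟧Q  ρ = Holds b (+ suc d ∣ℤ evalL t ρ)
⟦ and φ ψ ⟧Q    ρ = ⟦ φ ⟧Q ρ × ⟦ ψ ⟧Q ρ
⟦ or φ ψ ⟧Q     ρ = ⟦ φ ⟧Q ρ ⊎ ⟦ ψ ⟧Q ρ

Holds-cong : ∀ b {A B} → A ⇔ B → Holds b A ⇔ Holds b B
Holds-cong true  e = e
Holds-cong false e = mk⇔ (_∘ from e) (_∘ to e)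

Holds-dec : ∀ b {A} → Dec A → Dec (Holds b A)
Holds-dec true  d = d
Holds-dec false d = ¬? d

⟦_⟧Q? : ∀ {k} (φ : QF k) ρ → Dec (⟦ φ ⟧Q ρ)
⟦ positive t ⟧Q? ρ = + 0 ℤ.<? evalL t ρ
⟦ div d b t ⟧Q?  ρ = Holds-dec b (+ suc d ∣ℤ? evalL t ρ)
⟦ and φ ψ ⟧Q?    ρ = ⟦ φ ⟧Q? ρ ×-dec ⟦ ψ ⟧Q? ρ
⟦ or φ ψ ⟧Q?     ρ = ⟦ φ ⟧Q? ρ ⊎-dec ⟦ ψ ⟧Q? ρ

-- `QF` has no negation constructor because `descend` relies on `positive` atoms occurring only
-- positively. Over the integers `t ≤ 0` is `0 < 1 - t`, again an atom.
neg : ∀ {k} → QF k → QF k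
neg (positive t) = positive (constL (+ 1) ⊞ (-[1+ 0 ] ⊡ t))
neg (div d b t)  = div d (not b) t
neg (and φ ψ)    = or (neg φ) (neg ψ)
neg (or φ ψ)     = and (neg φ) (neg ψ)

0<1-v⇔v≮0 : ∀ v → + 0 ℤ.< + 1 ℤ.+ -[1+ 0 ] ℤ.* v ⇔ (¬ + 0 ℤ.< v)
0<1-v⇔v≮0 (+ zero)        = mk⇔ (λ { _ (ℤ.+<+ ()) }) (λ _ → ℤ.+<+ (s≤s z≤n))
0<1-v⇔v≮0 (+ suc zero)    = mk⇔ (λ { (ℤ.+<+ ()) }) (λ n → contradiction (ℤ.+<+ (s≤s z≤n)) n)
0<1-v⇔v≮0 (+ suc (suc n)) = mk⇔ (λ ()) (λ n → contradiction (ℤ.+<+ (s≤s z≤n)) n)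
0<1-v⇔v≮0 -[1+ n ]         = mk⇔ (λ _ ()) (λ _ → ℤ.+<+ (s≤s z≤n))

evalL-1- : ∀ {k} t (ρ : Vec ℕ k) →
           evalL (constL (+ 1) ⊞ (-[1+ 0 ] ⊡ t)) ρ ≡ + 1 ℤ.+ -[1+ 0 ] ℤ.* evalL t ρ
evalL-1- t ρ = trans (evalL-⊞ (constL (+ 1)) _ ρ) (cong₂ ℤ._+_ (evalL-const (+ 1) ρ) (evalL-⊡ -[1+ 0 ] t ρ))

neg-correct : ∀ {k} (φ : QF k) ρ → ⟦ neg φ ⟧Q ρ ⇔ (¬ ⟦ φ ⟧Q ρ)
neg-correct (positive t) ρ rewrite evalL-1- t ρ = 0<1-v⇔v≮0 (evalL t ρ)
neg-correct (div d true t)  ρ = ⇔-refl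
neg-correct (div d false t) ρ = mk⇔ (λ h ¬h → ¬h h) (decidable-stable (+ suc d ∣ℤ? evalL t ρ))
neg-correct (and φ ψ) ρ = mk⇔
  (λ { (inj₁ a) (p , _) → to (neg-correct φ ρ) a p ; (inj₂ b) (_ , q) → to (neg-correct ψ ρ) b q })
  (λ h → case ⟦ φ ⟧Q? ρ of λ where
    (yes p) → inj₂ (from (neg-correct ψ ρ) (λ q → h (p , q)))
    (no ¬p) → inj₁ (from (neg-correct φ ρ) ¬p))
neg-correct (or φ ψ) ρ = mk⇔
  (λ (a , b) → [ to (neg-correct φ ρ) a , to (neg-correct ψ ρ) b ]′)
  (λ h → from (neg-correct φ ρ) (h ∘ inj₁) , from (neg-correct ψ ρ) (h ∘ inj₂))

-- suc (period φ) is a common period of the divisibility atoms of φ.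
period : ∀ {k} → QF k → ℕ
period (positive t) = 0
period (div d b t)  = d
period (and φ ψ)    = period ψ + period φ * suc (period ψ)
period (or φ ψ)     = period ψ + period φ * suc (period ψ)

-- (a , t) stands for a lower bound -t / suc a of the eliminated variable.
lowerBounds : ∀ {k} → QF (suc k) → List (ℕ × Lin k)
lowerBounds (positive (+ suc a ▸ t))  = (a , t) ∷ []
lowerBounds (positive (+ 0 ▸ t))      = []
lowerBounds (positive (-[1+ a ] ▸ t)) = []
lowerBounds (div d b t)               = []
lowerBounds (and φ ψ)                 = lowerBounds φ List.++ lowerBounds ψ
lowerBounds (or φ ψ)                  = lowerBounds φ List.++ lowerBounds ψ

-- Finitely many values `(j - t) / suc a` lie within distance `D` above the bound. The offset
-- `j = 0` is included for the bound `0` on naturals, which can be attained.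
NearBound : ∀ {k} → ℕ → ℕ → Vec ℕ k → ℕ × Lin k → Set
NearBound D x ρ (a , t) = Σ ℕ λ j → j ≤ suc a * D × + suc a ℤ.* + x ℤ.+ evalL t ρ ≡ + j

shift : ∀ a x D v → a ℤ.* + (x + D) ℤ.+ v ≡ a ℤ.* + D ℤ.+ (a ℤ.* + x ℤ.+ v)
shift a x D v = trans (cong (λ y → a ℤ.* y ℤ.+ v) (ℤ.pos-+ x D)) (rearrange a (+ x) (+ D) v)
  where
  rearrange : ∀ a x D v → a ℤ.* (x ℤ.+ D) ℤ.+ v ≡ a ℤ.* D ℤ.+ (a ℤ.* x ℤ.+ v)
  rearrange = solve-∀

i≤0⇒i+j≤j : ∀ {i} j → i ℤ.≤ + 0 → i ℤ.+ j ℤ.≤ j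
i≤0⇒i+j≤j j i≤0 = ℤ.≤-trans (ℤ.+-monoˡ-≤ j i≤0) (ℤ.≤-reflexive (ℤ.+-identityˡ j))

∣-+ : ∀ {k i j} → k ∣ℤ i → k ∣ℤ i ℤ.+ j ⇔ k ∣ℤ j
∣-+ {k} {i} {j} k∣i = mk⇔
  (λ h → subst (k ∣ℤ_) (rearrange i j) (ℤ∣.∣m∣n⇒∣m+n h (ℤ∣.∣m⇒∣-m k∣i)))
  (ℤ∣.∣m∣n⇒∣m+n k∣i)
  where
  rearrange : ∀ i j → i ℤ.+ j ℤ.+ ℤ.- i ≡ j
  rearrange = solve-∀

-- Moving down by a common period can only fail just above a lower bound.
descend : ∀ {k} (φ : QF (suc k)) D → suc (period φ) ∣ D → ∀ x ρ →
          ⟦ φ ⟧Q (x + D ∷ ρ) → ⟦ φ ⟧Q (x ∷ ρ) ⊎ Any (NearBound D (x + D) ρ) (lowerBounds φ)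
descend (positive (+ zero ▸ t))   D _ x ρ h = inj₁ h
descend (positive (-[1+ a ] ▸ t)) D _ x ρ h = inj₁ (ℤ.<-≤-trans h
  (subst (ℤ._≤ v) (sym (shift -[1+ a ] x D (evalL t ρ)))
    (i≤0⇒i+j≤j v (ℤ.≤-trans (ℤ.*-monoˡ-≤-nonPos -[1+ a ] {+ 0} {+ D} (ℤ.+≤+ z≤n)) (ℤ.≤-reflexive (ℤ.*-zeroʳ -[1+ a ]))))))
  where v = -[1+ a ] ℤ.* + x ℤ.+ evalL t ρ
descend (positive (+ suc a ▸ t)) D _ x ρ h with + 0 ℤ.<? + suc a ℤ.* + x ℤ.+ evalL t ρ
... | yes p = inj₁ p
... | no ¬p = inj₂ (here (nat _ h le))
  where
  le : + suc a ℤ.* + (x + D) ℤ.+ evalL t ρ ℤ.≤ + (suc a * D)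
  le = subst₂ ℤ._≤_ (sym (shift (+ suc a) x D (evalL t ρ))) (trans (ℤ.+-identityʳ _) (sym (ℤ.pos-* (suc a) D)))
         (ℤ.+-monoʳ-≤ (+ suc a ℤ.* + D) (ℤ.≮⇒≥ ¬p))
  nat : ∀ v → + 0 ℤ.< v → v ℤ.≤ + (suc a * D) → Σ ℕ λ j → j ≤ suc a * D × v ≡ + j
  nat (+ j) _ (ℤ.+≤+ j≤) = j , j≤ , refl
descend (div d b (a ▸ t)) D d∣D x ρ h = inj₁ (to (Holds-cong b same) h)
  where
  same : + suc d ∣ℤ a ℤ.* + (x + D) ℤ.+ evalL t ρ ⇔ + suc d ∣ℤ a ℤ.* + x ℤ.+ evalL t ρ
  same rewrite shift a x D (evalL t ρ) = ∣-+ (ℤ∣.∣n⇒∣m*n a (ℤ∣.∣ᵤ⇒∣ d∣D))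
descend (and φ ψ) D p∣D x ρ (h₁ , h₂)
  with descend φ D (∣-trans (m∣m*n (suc (period ψ))) p∣D) x ρ h₁ | descend ψ D (∣-trans (n∣m*n (suc (period φ))) p∣D) x ρ h₂
... | inj₁ a | inj₁ b = inj₁ (a , b)
... | inj₂ a | _      = inj₂ (++⁺ˡ a)
... | inj₁ _ | inj₂ b = inj₂ (++⁺ʳ (lowerBounds φ) b)
descend (or φ ψ) D p∣D x ρ (inj₁ h) =
  map-⊎ inj₁ ++⁺ˡ (descend φ D (∣-trans (m∣m*n (suc (period ψ))) p∣D) x ρ h)
descend (or φ ψ) D p∣D x ρ (inj₂ h) =
  map-⊎ inj₂ (++⁺ʳ (lowerBounds φ)) (descend ψ D (∣-trans (n∣m*n (suc (period φ))) p∣D) x ρ h)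

-- Substitution of e / suc a for the first variable, after multiplication by suc a.
substL : ∀ {k} → ℕ → Lin k → Lin (suc k) → Lin k
substL a e (b ▸ t) = (b ⊡ e) ⊞ (+ suc a ⊡ t)

substQ : ∀ {k} → ℕ → Lin k → QF (suc k) → QF k
substQ a e (positive t) = positive (substL a e t)
-- The dividend was multiplied by `suc a`, so the modulus becomes `suc a * suc d`, stored as its
-- predecessor.
substQ a e (div d b t)  = div (d + a * suc d) b (substL a e t)
substQ a e (and φ ψ)    = and (substQ a e φ) (substQ a e ψ)
substQ a e (or φ ψ)     = or (substQ a e φ) (substQ a e ψ)

scale-pos : ∀ a v → + 0 ℤ.< + suc a ℤ.* v ⇔ + 0 ℤ.< v
scale-pos a v = mk⇔
  (λ h → ℤ.*-cancelˡ-<-nonNeg {+ 0} {v} (+ suc a) (subst (ℤ._< (+ suc a ℤ.* v)) (sym (ℤ.*-zeroʳ (+ suc a))) h))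
  (λ h → subst (ℤ._< (+ suc a ℤ.* v)) (ℤ.*-zeroʳ (+ suc a)) (ℤ.*-monoˡ-<-pos (+ suc a) h))

scale-∣ : ∀ a d v → + (suc a * suc d) ∣ℤ + suc a ℤ.* v ⇔ + suc d ∣ℤ v
scale-∣ a d v rewrite ℤ.pos-* (suc a) (suc d) = mk⇔ (ℤ∣.*-cancelˡ-∣ (+ suc a)) (ℤ∣.*-monoʳ-∣ (+ suc a))

module _ {k} (a : ℕ) (e : Lin k) (x : ℕ) (ρ : Vec ℕ k) (ax≡e : + suc a ℤ.* + x ≡ evalL e ρ) where

  substL-correct : ∀ t → evalL (substL a e t) ρ ≡ + suc a ℤ.* evalL t (x ∷ ρ)
  substL-correct (b ▸ t) = begin
    evalL ((b ⊡ e) ⊞ (+ suc a ⊡ t)) ρ                   ≡⟨ evalL-⊞ (b ⊡ e) _ ρ ⟩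
    evalL (b ⊡ e) ρ ℤ.+ evalL (+ suc a ⊡ t) ρ           ≡⟨ cong₂ ℤ._+_ (evalL-⊡ b e ρ) (evalL-⊡ (+ suc a) t ρ) ⟩
    b ℤ.* evalL e ρ ℤ.+ + suc a ℤ.* evalL t ρ           ≡⟨ cong (λ v → b ℤ.* v ℤ.+ + suc a ℤ.* evalL t ρ) (sym ax≡e) ⟩
    b ℤ.* (+ suc a ℤ.* + x) ℤ.+ + suc a ℤ.* evalL t ρ   ≡⟨ rearrange b (+ suc a) (+ x) _ ⟩
    + suc a ℤ.* (b ℤ.* + x ℤ.+ evalL t ρ)               ∎
    where
    open ≡-Reasoning
    rearrange : ∀ b a x t → b ℤ.* (a ℤ.* x) ℤ.+ a ℤ.* t ≡ a ℤ.* (b ℤ.* x ℤ.+ t)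
    rearrange = solve-∀

  substQ-correct : ∀ φ → ⟦ substQ a e φ ⟧Q ρ ⇔ ⟦ φ ⟧Q (x ∷ ρ)
  substQ-correct (positive t) rewrite substL-correct t = scale-pos a _
  substQ-correct (div d b t)  rewrite substL-correct t = Holds-cong b (scale-∣ a d _)
  substQ-correct (and φ ψ)    = substQ-correct φ ×-⇔ substQ-correct ψ
  substQ-correct (or φ ψ)     = substQ-correct φ ⊎-⇔ substQ-correct ψ

⋁≤ : ∀ {k} → ℕ → (ℕ → QF k) → QF k
⋁≤ zero    f = f 0
⋁≤ (suc n) f = or (f (suc n)) (⋁≤ n f)

⋁≤-correct : ∀ {k} n (f : ℕ → QF k) ρ → ⟦ ⋁≤ n f ⟧Q ρ ⇔ (Σ ℕ λ j → j ≤ n × ⟦ f j ⟧Q ρ)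
⋁≤-correct zero    f ρ = mk⇔ (λ h → 0 , z≤n , h) λ { (_ , z≤n , h) → h }
⋁≤-correct (suc n) f ρ = mk⇔
  (λ { (inj₁ h) → suc n , ℕ.≤-refl , h
     ; (inj₂ h) → let j , j≤n , h′ = to (⋁≤-correct n f ρ) h in j , ℕ.m≤n⇒m≤1+n j≤n , h′ })
  (λ (j , j≤ , h) → case ℕ.m≤n⇒m<n∨m≡n j≤ of λ where
    (inj₁ (s≤s j≤n)) → inj₂ (from (⋁≤-correct n f ρ) (j , j≤n , h))
    (inj₂ refl)      → inj₁ h)

⋁List : ∀ {k} {X : Set} → List X → (X → QF k) → QF k
⋁List []       f = positive (constL (+ 0))
⋁List (x ∷ xs) f = or (f x) (⋁List xs f)

⋁List-correct : ∀ {k} {X : Set} (xs : List X) (f : X → QF k) ρ → ⟦ ⋁List xs f ⟧Q ρ ⇔ Any (λ x → ⟦ f x ⟧Q ρ) xs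
⋁List-correct []       f ρ rewrite evalL-const (+ 0) ρ = mk⇔ (λ { (ℤ.+<+ ()) }) (λ ())
⋁List-correct (x ∷ xs) f ρ = mk⇔
  [ here , there ∘ to (⋁List-correct xs f ρ) ]′
  (λ { (here h) → inj₁ h ; (there h) → inj₂ (from (⋁List-correct xs f ρ) h) })

candidate : ∀ {k} → Lin k → ℕ → Lin k
candidate t j = constL (+ j) ⊞ (-[1+ 0 ] ⊡ t)

-- The quotient `e / suc a` is a natural number when it is integral and `0 ≤ e`, written
-- `0 < 1 + e`; the substitution then speaks of an actual witness.
tryCandidate : ∀ {k} → QF (suc k) → ℕ → Lin k → QF k
tryCandidate φ a e = and (div a true e) (and (positive (constL (+ 1) ⊞ e)) (substQ a e φ))

-- The extra bound `0` takes the place of the disjunct for arbitrarily small values in Cooper's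
-- method over the integers.
bounds : ∀ {k} → QF (suc k) → List (ℕ × Lin k)
bounds φ = (0 , constL (+ 0)) ∷ lowerBounds φ

elim : ∀ {k} → QF (suc k) → QF k
elim φ = ⋁List (bounds φ) λ (a , t) →
  ⋁≤ (suc a * suc (period φ)) λ j → tryCandidate φ a (candidate t j)

0≮1-[1+_] : ∀ n → ¬ + 0 ℤ.< + 1 ℤ.+ -[1+ n ]
0≮1-[1+ zero ]  (ℤ.+<+ ())
0≮1-[1+ suc n ] ()

tryCandidate-sound : ∀ {k} (φ : QF (suc k)) a e ρ → ⟦ tryCandidate φ a e ⟧Q ρ → Σ ℕ λ x → ⟦ φ ⟧Q (x ∷ ρ)
tryCandidate-sound φ a e ρ (divides q eq , nonneg , h) rewrite evalL-⊞ (constL (+ 1)) e ρ | evalL-const (+ 1) ρ = go q eq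
  where
  go : ∀ q → evalL e ρ ≡ q ℤ.* + suc a → Σ ℕ λ x → ⟦ φ ⟧Q (x ∷ ρ)
  go (+ x)    eq = x , to (substQ-correct a e x ρ (trans (ℤ.*-comm (+ suc a) (+ x)) (sym eq)) φ) h
  go -[1+ x ] eq = contradiction (subst (λ v → + 0 ℤ.< + 1 ℤ.+ v) eq nonneg) 0≮1-[1+ a + x * suc a ]

tryCandidate-complete : ∀ {k} (φ : QF (suc k)) a e x ρ → + suc a ℤ.* + x ≡ evalL e ρ →
                        ⟦ φ ⟧Q (x ∷ ρ) → ⟦ tryCandidate φ a e ⟧Q ρ
tryCandidate-complete φ a e x ρ ax≡e h =
    divides (+ x) (trans (sym ax≡e) (ℤ.*-comm (+ suc a) (+ x)))
  , subst (+ 0 ℤ.<_) (sym (trans (evalL-⊞ (constL (+ 1)) e ρ) (cong₂ ℤ._+_ (evalL-const (+ 1) ρ) (trans (sym ax≡e) (sym (ℤ.pos-* (suc a) x))))))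
      (ℤ.+<+ (s≤s z≤n))
  , from (substQ-correct a e x ρ ax≡e φ) h

NearBound⇒candidate : ∀ {k x} {ρ : Vec ℕ k} a t j → + suc a ℤ.* + x ℤ.+ evalL t ρ ≡ + j →
                      + suc a ℤ.* + x ≡ evalL (candidate t j) ρ
NearBound⇒candidate {x = x} {ρ} a t j eq = begin
  + suc a ℤ.* + x                                       ≡⟨ rearrange (+ suc a ℤ.* + x) (evalL t ρ) ⟩
  + suc a ℤ.* + x ℤ.+ evalL t ρ ℤ.+ -[1+ 0 ] ℤ.* evalL t ρ ≡⟨ cong (ℤ._+ -[1+ 0 ] ℤ.* evalL t ρ) eq ⟩
  + j ℤ.+ -[1+ 0 ] ℤ.* evalL t ρ                        ≡⟨ cong₂ ℤ._+_ (evalL-const (+ j) ρ) (evalL-⊡ -[1+ 0 ] t ρ) ⟨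
  evalL (constL (+ j)) ρ ℤ.+ evalL (-[1+ 0 ] ⊡ t) ρ     ≡⟨ evalL-⊞ (constL (+ j)) _ ρ ⟨
  evalL (candidate t j) ρ ∎
  where
  open ≡-Reasoning
  rearrange : ∀ u v → u ≡ u ℤ.+ v ℤ.+ -[1+ 0 ] ℤ.* v
  rearrange = solve-∀

-- Completeness is a descent from a witness in steps of the period `D`. It stops just above a lower
-- bound of `φ`, or below `D` and hence near the bound `0`; candidates cover both.
elim-correct : ∀ {k} (φ : QF (suc k)) ρ → ⟦ elim φ ⟧Q ρ ⇔ (Σ ℕ λ x → ⟦ φ ⟧Q (x ∷ ρ))
elim-correct {k} φ ρ = mk⇔ sound λ (x , h) → from (⋁List-correct (bounds φ) _ ρ) (<-rec _ complete x h)
  where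
  D = suc (period φ)
  Hit : ℕ × Lin k → Set
  Hit (a , t) = ⟦ (⋁≤ (suc a * D) λ j → tryCandidate φ a (candidate t j)) ⟧Q ρ
  sound : ⟦ elim φ ⟧Q ρ → Σ ℕ λ x → ⟦ φ ⟧Q (x ∷ ρ)
  sound h with satisfied (to (⋁List-correct (bounds φ) _ ρ) h)
  ... | (a , t) , h′ = let j , _ , h″ = to (⋁≤-correct (suc a * D) _ ρ) h′
                       in tryCandidate-sound φ a (candidate t j) ρ h″
  hit : ∀ x → ⟦ φ ⟧Q (x ∷ ρ) → ∀ {b} → NearBound D x ρ b → Hit b
  hit x h {a , t} (j , j≤ , eq) = from (⋁≤-correct (suc a * D) _ ρ)
    (j , j≤ , tryCandidate-complete φ a (candidate t j) x ρ (NearBound⇒candidate {x = x} {ρ} a t j eq) h)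
  complete : ∀ x → (∀ {y} → y < x → ⟦ φ ⟧Q (y ∷ ρ) → Any Hit (bounds φ)) → ⟦ φ ⟧Q (x ∷ ρ) → Any Hit (bounds φ)
  complete x rec h with D ℕ.≤? x
  ... | no x<D = here (hit x h (x , ℕ.≤-trans (ℕ.<⇒≤ (ℕ.≰⇒> x<D)) (ℕ.≤-reflexive (sym (ℕ.*-identityˡ D)))
                 , trans (cong₂ ℤ._+_ (ℤ.*-identityˡ (+ x)) (evalL-const (+ 0) ρ)) (ℤ.+-identityʳ (+ x))))
  ... | yes D≤x with descend φ D ∣-refl (x ∸ D) ρ (subst (λ y → ⟦ φ ⟧Q (y ∷ ρ)) (sym (ℕ.m∸n+n≡m D≤x)) h)
  ...   | inj₁ h′ = rec (ℕ.∸-monoʳ-< {x} (s≤s z≤n) D≤x) h′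
  ...   | inj₂ near = there (Any.map (hit x h)
                        (subst (λ y → Any (NearBound D y ρ) (lowerBounds φ)) (ℕ.m∸n+n≡m D≤x) near))

-- Presburger definable predicates

-- The definition is quantifier-free even when `P` is stated with quantifiers, so `P` is decidable
-- at every valuation. `def-→` and `def-∀` use this to reduce to `¬`, `⊎` and `∃`.
record Definable {k} (P : Vec ℕ k → Set) : Set where
  constructor definedBy
  field
    formula : QF k
    correct : ∀ ρ → ⟦ formula ⟧Q ρ ⇔ P ρ

open Definable

private
  variable
    k : ℕ
    P Q : Vec ℕ k → Set

def-cong : (∀ ρ → P ρ ⇔ Q ρ) → Definable P → Definable Q
def-cong e (definedBy φ c) = definedBy φ λ ρ → ⇔-trans (c ρ) (e ρ)

def-dec : Definable P → ∀ ρ → Dec (P ρ)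
def-dec (definedBy φ c) ρ = map-dec (c ρ) (⟦ φ ⟧Q? ρ)

def-¬ : Definable P → Definable (λ ρ → ¬ P ρ)
def-¬ (definedBy φ c) = definedBy (neg φ) λ ρ → ⇔-trans (neg-correct φ ρ) (Holds-cong false (c ρ))

def-× : Definable P → Definable Q → Definable (λ ρ → P ρ × Q ρ)
def-× (definedBy φ c) (definedBy ψ d) = definedBy (and φ ψ) λ ρ → c ρ ×-⇔ d ρ

def-⊎ : Definable P → Definable Q → Definable (λ ρ → P ρ ⊎ Q ρ)
def-⊎ (definedBy φ c) (definedBy ψ d) = definedBy (or φ ψ) λ ρ → c ρ ⊎-⇔ d ρ

def-→ : Definable P → Definable Q → Definable (λ ρ → P ρ → Q ρ)
def-→ p q = def-cong
  (λ ρ → mk⇔ (λ { (inj₁ ¬a) a → contradiction a ¬a ; (inj₂ b) _ → b })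
             (λ h → case def-dec p ρ of λ where
               (yes a) → inj₂ (h a)
               (no ¬a) → inj₁ ¬a))
  (def-⊎ (def-¬ p) q)

def-∃ : {P : Vec ℕ (suc k) → Set} → Definable P → Definable (λ ρ → Σ ℕ λ x → P (x ∷ ρ))
def-∃ (definedBy φ c) = definedBy (elim φ) λ ρ → ⇔-trans (elim-correct φ ρ)
  (mk⇔ (map₂ (λ {x} → to (c (x ∷ ρ)))) (map₂ (λ {x} → from (c (x ∷ ρ)))))

def-∀ : {P : Vec ℕ (suc k) → Set} → Definable P → Definable (λ ρ → ∀ x → P (x ∷ ρ))
def-∀ p = def-cong
  (λ ρ → mk⇔ (λ h x → decidable-stable (def-dec p (x ∷ ρ)) (λ ¬p → h (x , ¬p))) (λ h (x , ¬p) → ¬p (h x)))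
  (def-¬ (def-∃ (def-¬ p)))

def-⊤ : Definable {k} (λ _ → ⊤)
def-⊤ {k} = definedBy (neg (positive (constL (+ 0)))) λ ρ → mk⇔ (λ _ → tt)
  (λ _ → from (neg-correct (positive (constL (+ 0))) ρ) λ 0<0 → ℤ.<-irrefl refl (subst (+ 0 ℤ.<_) (evalL-const (+ 0) ρ) 0<0))

def-const : ∀ {A : Set} → Dec A → Definable {k} (λ _ → A)
def-const (yes a) = def-cong (λ _ → mk⇔ (λ _ → a) (λ _ → tt)) def-⊤
def-const (no ¬a) = def-cong (λ _ → mk⇔ (λ n → ⊥-elim (n tt)) (λ a _ → ¬a a)) (def-¬ def-⊤)

def-∀Fin : ∀ {n} {P : Fin n → Vec ℕ k → Set} → (∀ i → Definable (P i)) → Definable (λ ρ → ∀ i → P i ρ)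
def-∀Fin {n = zero}  p = def-cong (λ _ → mk⇔ (λ _ ()) (λ _ → tt)) def-⊤
def-∀Fin {n = suc n} p = def-cong
  (λ _ → mk⇔ (λ { (h , hs) zero → h ; (h , hs) (suc i) → hs i }) (λ h → h zero , h ∘ suc))
  (def-× (p zero) (def-∀Fin (p ∘ suc)))

def-∃Vec : ∀ j {P : Vec ℕ (j + k) → Set} → Definable P → Definable {k} (λ ρ → Σ (Vec ℕ j) λ v → P (v Vec.++ ρ))
def-∃Vec zero    p = def-cong (λ _ → mk⇔ ([] ,_) (λ { ([] , h) → h })) p
def-∃Vec (suc j) p = def-cong
  (λ _ → mk⇔ (λ (v , x , h) → x ∷ v , h) (λ { (x ∷ v , h) → v , x , h }))
  (def-∃Vec j (def-∃ p))

-- Elimination works on vectors while distributions are functions. A function matches the vector of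
-- its values only pointwise, which explains the form of the second hypothesis.
def-∃Fun : ∀ j {P : Vec ℕ (j + k) → Set} {Q : Vec ℕ k → (Fin j → ℕ) → Set} → Definable P →
           (∀ ρ v f → (∀ i → lookup v i ≡ f i) → P (v Vec.++ ρ) ⇔ Q ρ f) →
           Definable (λ ρ → Σ (Fin j → ℕ) (Q ρ))
def-∃Fun j p e = def-cong
  (λ ρ → mk⇔ (λ (v , h) → lookup v , to (e ρ v (lookup v) (λ _ → refl)) h)
             (λ (f , h) → tabulate f , from (e ρ (tabulate f) f (Vec.lookup∘tabulate f)) h))
  (def-∃Vec j p)

-- Presburger terms and guards

⟦_⟧T : PTerm k → Vec ℕ k → ℕ
⟦ t ⟧T ρ = evalT t (lookup ρ)

linear : PTerm k → Lin k
linear (pconst c) = constL (+ c)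
linear (pvar i)   = varL i
linear (t ⊕ u)    = linear t ⊞ linear u
linear (c ⊛ t)    = + c ⊡ linear t

linear-correct : (t : PTerm k) (ρ : Vec ℕ k) → evalL (linear t) ρ ≡ + ⟦ t ⟧T ρ
linear-correct (pconst c) ρ = evalL-const (+ c) ρ
linear-correct (pvar i)   ρ = evalL-var i ρ
linear-correct (t ⊕ u)    ρ = trans (evalL-⊞ (linear t) (linear u) ρ)
  (trans (cong₂ ℤ._+_ (linear-correct t ρ) (linear-correct u ρ)) (sym (ℤ.pos-+ (⟦ t ⟧T ρ) (⟦ u ⟧T ρ))))
linear-correct (c ⊛ t)    ρ = trans (evalL-⊡ (+ c) (linear t) ρ)
  (trans (cong (λ v → + c ℤ.* v) (linear-correct t ρ)) (sym (ℤ.pos-* c (⟦ t ⟧T ρ))))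

difference : PTerm k → PTerm k → Lin k
difference t u = linear t ⊞ (-[1+ 0 ] ⊡ linear u)

difference-correct : (t u : PTerm k) (ρ : Vec ℕ k) → evalL (difference t u) ρ ≡ + ⟦ t ⟧T ρ ℤ.- + ⟦ u ⟧T ρ
difference-correct t u ρ = trans (evalL-⊞ (linear t) _ ρ) (cong₂ ℤ._+_ (linear-correct t ρ)
  (trans (evalL-⊡ -[1+ 0 ] (linear u) ρ) (trans (ℤ.-1*i≡-i _) (cong ℤ.-_ (linear-correct u ρ)))))

i-j+j : ∀ i j → i ℤ.- j ℤ.+ j ≡ i
i-j+j = solve-∀

0<m-n⇔n<m : ∀ m n → + 0 ℤ.< + m ℤ.- + n ⇔ n < m
0<m-n⇔n<m m n = mk⇔
  (λ h → ℤ.drop‿+<+ (subst₂ ℤ._<_ (ℤ.+-identityˡ (+ n)) (i-j+j (+ m) (+ n)) (ℤ.+-monoˡ-< (+ n) h)))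
  (λ h → subst (ℤ._< + m ℤ.- + n) (ℤ.+-inverseʳ (+ n)) (ℤ.+-monoˡ-< (ℤ.- + n) (ℤ.+<+ h)))

def-≤ : (t u : PTerm k) → Definable (λ ρ → ⟦ t ⟧T ρ ≤ ⟦ u ⟧T ρ)
def-≤ t u = def-cong (λ _ → mk⇔ ℕ.≮⇒≥ ℕ.≤⇒≯) (def-¬ (definedBy (positive (difference t u)) λ ρ →
  subst (λ v → + 0 ℤ.< v ⇔ ⟦ u ⟧T ρ < ⟦ t ⟧T ρ) (sym (difference-correct t u ρ)) (0<m-n⇔n<m _ _)))

def-≡ : (t u : PTerm k) → Definable (λ ρ → ⟦ t ⟧T ρ ≡ ⟦ u ⟧T ρ)
def-≡ t u = def-cong
  (λ _ → mk⇔ (λ (p , q) → ℕ.≤-antisym p q) (λ p → ℕ.≤-reflexive p , ℕ.≤-reflexive (sym p)))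
  (def-× (def-≤ t u) (def-≤ u t))

m≡n+q*c⇒%≡ : ∀ c m n q → + m ℤ.- + n ≡ + q ℤ.* + suc c → m ℕ.% suc c ≡ n ℕ.% suc c
m≡n+q*c⇒%≡ c m n q eq = trans (cong (ℕ._% suc c) m≡) (ℕ.[m+kn]%n≡m%n n q (suc c))
  where
  m≡ : m ≡ n + q * suc c
  m≡ = ℤ.+-injective (trans (sym (i-j+j (+ m) (+ n)))
    (trans (cong (ℤ._+ + n) (trans eq (sym (ℤ.pos-* q (suc c)))))
      (trans (sym (ℤ.pos-+ (q * suc c) n)) (cong +_ (ℕ.+-comm (q * suc c) n)))))

∣m-n⇔%≡ : ∀ c m n → + suc c ∣ℤ + m ℤ.- + n ⇔ m ℕ.% suc c ≡ n ℕ.% suc c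
∣m-n⇔%≡ c m n = mk⇔ (λ (divides q eq) → forward q eq) backward
  where
  swap : ∀ i j → j ℤ.- i ≡ ℤ.- (i ℤ.- j)
  swap = solve-∀
  forward : ∀ q → + m ℤ.- + n ≡ q ℤ.* + suc c → m ℕ.% suc c ≡ n ℕ.% suc c
  forward (+ q)    eq = m≡n+q*c⇒%≡ c m n q eq
  forward -[1+ q ] eq = sym (m≡n+q*c⇒%≡ c n m (suc q)
    (trans (swap (+ m) (+ n)) (trans (cong ℤ.-_ eq) (ℤ.neg-distribˡ-* -[1+ q ] (+ suc c)))))
  split : ∀ m → + m ≡ + (m ℕ.% suc c) ℤ.+ + (m ℕ./ suc c) ℤ.* + suc c
  split m = trans (cong +_ (ℕ.m≡m%n+[m/n]*n m (suc c)))
    (trans (ℤ.pos-+ (m ℕ.% suc c) _) (cong (λ v → + (m ℕ.% suc c) ℤ.+ v) (ℤ.pos-* (m ℕ./ suc c) (suc c))))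
  rearrange : ∀ r p q d → r ℤ.+ p ℤ.* d ℤ.- (r ℤ.+ q ℤ.* d) ≡ (p ℤ.- q) ℤ.* d
  rearrange = solve-∀
  backward : m ℕ.% suc c ≡ n ℕ.% suc c → + suc c ∣ℤ + m ℤ.- + n
  backward eq = divides (+ (m ℕ./ suc c) ℤ.- + (n ℕ./ suc c))
    (trans (cong₂ ℤ._-_ (trans (split m) (cong (λ r → + r ℤ.+ + (m ℕ./ suc c) ℤ.* + suc c) eq)) (split n))
      (rearrange (+ (n ℕ.% suc c)) (+ (m ℕ./ suc c)) (+ (n ℕ./ suc c)) (+ suc c)))

def-%≡ : ∀ c (t u : PTerm k) → Definable (λ ρ → ⟦ t ⟧T ρ ℕ.% suc c ≡ ⟦ u ⟧T ρ ℕ.% suc c)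
def-%≡ c t u = definedBy (div c true (difference t u)) λ ρ →
  subst (λ v → + suc c ∣ℤ v ⇔ ⟦ t ⟧T ρ ℕ.% suc c ≡ ⟦ u ⟧T ρ ℕ.% suc c) (sym (difference-correct t u ρ)) (∣m-n⇔%≡ c (⟦ t ⟧T ρ) (⟦ u ⟧T ρ))

evalT-cong : (t : PTerm k) {x y : Fin k → ℕ} → (∀ i → x i ≡ y i) → evalT t x ≡ evalT t y
evalT-cong (pconst c) e = refl
evalT-cong (pvar i)   e = e i
evalT-cong (t ⊕ u)    e = cong₂ _+_ (evalT-cong t e) (evalT-cong u e)
evalT-cong (c ⊛ t)    e = cong (c *_) (evalT-cong t e)

evalG-cong : (g : Guard k) {x y : Fin k → ℕ} → (∀ i → x i ≡ y i) → evalG g x ≡ evalG g y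
evalG-cong gtrue         e = refl
evalG-cong gfalse        e = refl
evalG-cong (t ≤g u)      e = cong₂ ℕ._≤ᵇ_ (evalT-cong t e) (evalT-cong u e)
evalG-cong (t ≐g u)      e = cong₂ ℕ._≡ᵇ_ (evalT-cong t e) (evalT-cong u e)
evalG-cong (congr c t u) e =
  cong₂ (λ m n → (m ℕ.% suc c) ℕ.≡ᵇ (n ℕ.% suc c)) (evalT-cong t e) (evalT-cong u e)
evalG-cong (gnot g)      e = cong not (evalG-cong g e)
evalG-cong (gand g h)    e = cong₂ _∧_ (evalG-cong g e) (evalG-cong h e)
evalG-cong (gor g h)     e = cong₂ _∨_ (evalG-cong g e) (evalG-cong h e)

substT : ∀ {n} → PTerm n → (Fin n → PTerm k) → PTerm k
substT (pconst c) ts = pconst c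
substT (pvar i)   ts = ts i
substT (t ⊕ u)    ts = substT t ts ⊕ substT u ts
substT (c ⊛ t)    ts = c ⊛ substT t ts

evalT-subst : ∀ {n} (t : PTerm n) (ts : Fin n → PTerm k) x → evalT (substT t ts) x ≡ evalT t (λ i → evalT (ts i) x)
evalT-subst (pconst c) ts x = refl
evalT-subst (pvar i)   ts x = refl
evalT-subst (t ⊕ u)    ts x = cong₂ _+_ (evalT-subst t ts x) (evalT-subst u ts x)
evalT-subst (c ⊛ t)    ts x = cong (c *_) (evalT-subst t ts x)

T-not : ∀ b → (¬ T b) ⇔ T (not b)
T-not true  = mk⇔ (λ h → h tt) (λ ())
T-not false = mk⇔ (λ _ → tt) (λ _ ())

def-guard : ∀ {n} (g : Guard n) (ts : Fin n → PTerm k) → Definable (λ ρ → T (evalG g (λ i → ⟦ ts i ⟧T ρ)))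
def-guard gtrue  ts = def-⊤
def-guard gfalse ts = def-const (no (λ ()))
def-guard (t ≤g u) ts = def-cong
  (λ ρ → subst₂ (λ m n → m ≤ n ⇔ T (evalT t _ ℕ.≤ᵇ evalT u _)) (sym (evalT-subst t ts _)) (sym (evalT-subst u ts _))
           (mk⇔ ℕ.≤⇒≤ᵇ (ℕ.≤ᵇ⇒≤ _ _)))
  (def-≤ (substT t ts) (substT u ts))
def-guard (t ≐g u) ts = def-cong
  (λ ρ → subst₂ (λ m n → m ≡ n ⇔ T (evalT t _ ℕ.≡ᵇ evalT u _)) (sym (evalT-subst t ts _)) (sym (evalT-subst u ts _))
           (mk⇔ (ℕ.≡⇒≡ᵇ _ _) (ℕ.≡ᵇ⇒≡ _ _)))
  (def-≡ (substT t ts) (substT u ts))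
def-guard (congr c t u) ts = def-cong
  (λ ρ → subst₂ (λ m n → m ℕ.% suc c ≡ n ℕ.% suc c ⇔ T ((evalT t _ ℕ.% suc c) ℕ.≡ᵇ (evalT u _ ℕ.% suc c)))
           (sym (evalT-subst t ts _)) (sym (evalT-subst u ts _)) (mk⇔ (ℕ.≡⇒≡ᵇ _ _) (ℕ.≡ᵇ⇒≡ _ _)))
  (def-%≡ c (substT t ts) (substT u ts))
def-guard (gnot g)   ts = def-cong (λ _ → T-not _) (def-¬ (def-guard g ts))
def-guard (gand g h) ts = def-cong (λ _ → ⇔-sym T-∧) (def-× (def-guard g ts) (def-guard h ts))
def-guard (gor g h)  ts = def-cong (λ _ → ⇔-sym T-∨) (def-⊎ (def-guard g ts) (def-guard h ts))

sumT : ∀ {n} → (Fin n → PTerm k) → PTerm k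
sumT {n = zero}  ts = pconst 0
sumT {n = suc n} ts = ts zero ⊕ sumT (ts ∘ suc)

evalT-sum : ∀ {n} (ts : Fin n → PTerm k) x → evalT (sumT ts) x ≡ sumF (λ i → evalT (ts i) x)
evalT-sum {n = zero}  ts x = refl
evalT-sum {n = suc n} ts x = cong (λ s → evalT (ts zero) x + s) (evalT-sum (ts ∘ suc) x)

sumF-cong : ∀ {n} {f g : Fin n → ℕ} → (∀ i → f i ≡ g i) → sumF f ≡ sumF g
sumF-cong {zero}  e = refl
sumF-cong {suc n} e = cong₂ _+_ (e zero) (sumF-cong (e ∘ suc))

weaken : ∀ j → PTerm k → PTerm (j + k)
weaken j t = substT t (λ i → pvar (j ↑ʳ i))

weaken-correct : ∀ {j} (t : PTerm k) (v : Vec ℕ j) ρ → ⟦ weaken j t ⟧T (v Vec.++ ρ) ≡ ⟦ t ⟧T ρ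
weaken-correct t v ρ = trans (evalT-subst t _ _) (evalT-cong t (Vec.lookup-++ʳ v ρ))

-- Limits of monotone predicates

Improves : YVar → ℕ → ℕ → Set
Improves 𝕪₁ a b = a ≤ b
Improves 𝕪₂ a b = b ≤ a

Quantified : Quant → (ℕ → Set) → Set
Quantified ∀q X = ∀ n → X n
Quantified ∃q X = Σ ℕ X

Quantified-map : ∀ q {X Y : ℕ → Set} → (∀ n → X n → Y n) → Quantified q X → Quantified q Y
Quantified-map ∀q f h n = f n (h n)
Quantified-map ∃q f (n , h) = n , f n h

Quantified-cong : ∀ q {X Y : ℕ → Set} → (∀ n → X n ⇔ Y n) → Quantified q X ⇔ Quantified q Y
Quantified-cong q e = mk⇔ (Quantified-map q (to ∘ e)) (Quantified-map q (from ∘ e))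

def-Quantified : ∀ q {P : Vec ℕ (suc k) → Set} → Definable P → Definable (λ ρ → Quantified q λ x → P (x ∷ ρ))
def-Quantified ∀q = def-∀
def-Quantified ∃q = def-∃

-- The value at which a quantifier over y_i is decided: 0 (false) or every large number (true).
-- A variable of negative polarity is bound by the dual of the quantifier it came from.
limit : Quant → YVar → Bool → Bool
limit ∀q 𝕪₁ p = not p
limit ∃q 𝕪₁ p = p
limit ∀q 𝕪₂ p = p
limit ∃q 𝕪₂ p = not p

-- Below a negation `push` dualizes the prefix and the polarity flips; the two changes cancel, so
-- the limit point does not move.
limit-dual : ∀ q i p → limit (dualQ q) i (not p) ≡ limit q i p
limit-dual ∀q 𝕪₁ p     = refl
limit-dual ∃q 𝕪₁ true  = refl
limit-dual ∃q 𝕪₁ false = refl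
limit-dual ∀q 𝕪₂ true  = refl
limit-dual ∀q 𝕪₂ false = refl
limit-dual ∃q 𝕪₂ p     = refl

AtLimit : Bool → (ℕ → Set) → Set
AtLimit false X = X 0
AtLimit true  X = Σ ℕ λ N → ∀ n → N ≤ n → X n

-- A proper filter on ℕ for each `b`, principal at 0 or generated by the final segments. The record
-- keeps `b` and `X` inferable, which the recursively defined `AtLimit` does not.
record Eventually (b : Bool) (X : ℕ → Set) : Set where
  constructor eventually
  field atLimit : AtLimit b X

open Eventually

ev-map : ∀ {b} {X Y : ℕ → Set} → (∀ n → X n → Y n) → Eventually b X → Eventually b Y
ev-map {false} f (eventually h)       = eventually (f 0 h)
ev-map {true}  f (eventually (N , h)) = eventually (N , λ n N≤n → f n (h n N≤n))

ev-pure : ∀ {b} {X : ℕ → Set} → (∀ n → X n) → Eventually b X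
ev-pure {false} h = eventually (h 0)
ev-pure {true}  h = eventually (0 , λ n _ → h n)

ev-zip : ∀ {b} {X Y Z : ℕ → Set} → (∀ n → X n → Y n → Z n) → Eventually b X → Eventually b Y → Eventually b Z
ev-zip {false} f (eventually h) (eventually h′) = eventually (f 0 h h′)
ev-zip {true}  f (eventually (N , h)) (eventually (N′ , h′)) = eventually (N + N′ , λ n le →
  f n (h n (ℕ.≤-trans (ℕ.m≤m+n N N′) le)) (h′ n (ℕ.≤-trans (ℕ.m≤n+m N′ N) le)))

ev-∃ : ∀ {b} {X : ℕ → Set} → Eventually b X → Σ ℕ X
ev-∃ {false} (eventually h)       = 0 , h
ev-∃ {true}  (eventually (N , h)) = N , h N ℕ.≤-refl

ev-∀Fin : ∀ {b n} {X : Fin n → ℕ → Set} → (∀ i → Eventually b (X i)) → Eventually b (λ a → ∀ i → X i a)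
ev-∀Fin {n = zero}  h = ev-pure λ _ ()
ev-∀Fin {n = suc n} h = ev-zip (λ { a x xs zero → x ; a x xs (suc i) → xs i }) (h zero) (ev-∀Fin (h ∘ suc))

ev-∀Vec : ∀ {b n} {X : Vec Bool n → ℕ → Set} → (∀ A → Eventually b (X A)) → Eventually b (λ a → ∀ A → X A a)
ev-∀Vec {n = zero}  h = ev-map (λ { a x [] → x }) (h [])
ev-∀Vec {n = suc n} h = ev-zip (λ { a x y (true ∷ A) → x A ; a x y (false ∷ A) → y A })
  (ev-∀Vec λ A → h (true ∷ A)) (ev-∀Vec λ A → h (false ∷ A))

-- Monotonicity carries `X` between an arbitrary value and one where it is known to be `L`: the
-- value 0 for `∀ y₁` and `∃ y₂`, one past the threshold for `∃ y₁` and `∀ y₂`.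
collapse : ∀ q i {X : ℕ → Set} {L : Set} → (∀ {a b} → Improves i a b → X a → X b) →
           Eventually (limit q i true) (λ a → X a ⇔ L) → Quantified q X ⇔ L
collapse ∀q 𝕪₁ mono (eventually e)       = mk⇔ (λ h → to e (h 0)) (λ l n → mono z≤n (from e l))
collapse ∃q 𝕪₁ mono (eventually (N , e)) = mk⇔
  (λ (a , x) → to (e (a + N) (ℕ.m≤n+m N a)) (mono (ℕ.m≤m+n a N) x))
  (λ l → N , from (e N ℕ.≤-refl) l)
collapse ∀q 𝕪₂ mono (eventually (N , e)) = mk⇔
  (λ h → to (e N ℕ.≤-refl) (h N))
  (λ l n → mono (ℕ.m≤m+n n N) (from (e (n + N) (ℕ.m≤n+m N n)) l))
collapse ∃q 𝕪₂ mono (eventually e)       = mk⇔ (λ (a , x) → to e (mono z≤n x)) (λ l → 0 , from e l)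

-- Whether a definable monotone predicate ever changes is decidable, and then it changes only once.
stabilizes : ∀ q i {X : ℕ → Set} → (∀ {a b} → Improves i a b → X a → X b) →
             Definable {1} (λ ρ → X (lookup ρ zero)) → AtLimit (limit q i true) (λ a → X a ⇔ Quantified q X)
stabilizes ∀q 𝕪₁ mono def = mk⇔ (λ x n → mono z≤n x) (λ h → h 0)
stabilizes ∃q 𝕪₁ mono def with def-dec (def-∃ def) []
... | yes (N , x) = N , λ n N≤n → mk⇔ (n ,_) (λ _ → mono N≤n x)
... | no ¬x       = 0 , λ n _ → mk⇔ (n ,_) (λ x → contradiction x ¬x)
stabilizes ∀q 𝕪₂ mono def with def-dec (def-∃ (def-¬ def)) []
... | yes (N , ¬x) = N , λ n N≤n → mk⇔ (λ x → contradiction (mono N≤n x) ¬x) (λ h → h n)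
... | no ¬¬x       = 0 , λ n _ → mk⇔ (λ _ m → decidable-stable (def-dec def (m ∷ [])) (λ ¬x → ¬¬x (m , ¬x))) (λ h → h n)
stabilizes ∃q 𝕪₂ mono def = mk⇔ (0 ,_) (λ (_ , x) → mono z≤n x)

-- Assignments compared along polarities

record _≈A_ (θ θ′ : Asg) : Set where
  constructor agree
  field
    yv≡ : ∀ i → Asg.yv θ i ≡ Asg.yv θ′ i
    zv≡ : ∀ k → Asg.zv θ k ≡ Asg.zv θ′ k

open _≈A_

≈-sym : ∀ {θ θ′} → θ ≈A θ′ → θ′ ≈A θ
≈-sym e = agree (sym ∘ yv≡ e) (sym ∘ zv≡ e)

-- o p tells whether the variable occurs negatively in a formula placed at polarity p.
data Related (i : YVar) (o : Bool → Bool) (a b : ℕ) : Set where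
  equal  : a ≡ b → Related i o a b
  better : Improves i a b → o true ≡ false → Related i o a b
  worse  : Improves i b a → o false ≡ false → Related i o a b

Related-map : ∀ {i o o′ a b} → (∀ p → o p ≡ false → o′ p ≡ false) → Related i o a b → Related i o′ a b
Related-map f (equal e)    = equal e
Related-map f (better r h) = better r (f true h)
Related-map f (worse r h)  = worse r (f false h)

Related-¬ : ∀ {i o a b} → Related i (o ∘ not) a b → Related i o b a
Related-¬ (equal e)    = equal (sym e)
Related-¬ (better r h) = worse r h
Related-¬ (worse r h)  = better r h

∨-falseˡ : ∀ x {y} → x ∨ y ≡ false → x ≡ false
∨-falseˡ false _ = refl

∨-falseʳ : ∀ x {y} → x ∨ y ≡ false → y ≡ false
∨-falseʳ false h = h

record Related* (o : YVar → Bool → Bool) (θ θ′ : Asg) : Set where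
  constructor related
  field
    onY : ∀ i → Related i (o i) (Asg.yv θ i) (Asg.yv θ′ i)
    onZ : ∀ k → Asg.zv θ k ≡ Asg.zv θ′ k

open Related*

Related*-map : ∀ {o o′ θ θ′} → (∀ i p → o i p ≡ false → o′ i p ≡ false) → Related* o θ θ′ → Related* o′ θ θ′
Related*-map f r = related (λ i → Related-map (f i) (onY r i)) (onZ r)

Related*-¬ : ∀ {o θ θ′} → Related* (λ i p → o i (not p)) θ θ′ → Related* o θ′ θ
Related*-¬ r = related (λ i → Related-¬ (onY r i)) (sym ∘ onZ r)

≈⇒Related* : ∀ {o θ θ′} → θ ≈A θ′ → Related* o θ θ′
≈⇒Related* e = related (equal ∘ yv≡ e) (zv≡ e)

Related*-update : ∀ {o θ θ′} j n → Related* (λ i p → if sameY i j then false else o i p) θ θ′ →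
                  Related* o (θ [ j ↦ n ]) (θ′ [ j ↦ n ])
Related*-update {o} {θ} {θ′} j n r = related (onY′ j r) (onZ r)
  where
  onY′ : ∀ j → Related* (λ i p → if sameY i j then false else o i p) θ θ′ →
         ∀ i → Related i (o i) (Asg.yv (θ [ j ↦ n ]) i) (Asg.yv (θ′ [ j ↦ n ]) i)
  onY′ 𝕪₁ r 𝕪₁ = equal refl
  onY′ 𝕪₁ r 𝕪₂ = onY r 𝕪₂
  onY′ 𝕪₂ r 𝕪₁ = onY r 𝕪₁
  onY′ 𝕪₂ r 𝕪₂ = equal refl

Improves-update : ∀ {o θ a b} i → Improves i a b → o i true ≡ false → Related* o (θ [ i ↦ a ]) (θ [ i ↦ b ])
Improves-update 𝕪₁ le h = related (λ { 𝕪₁ → better le h ; 𝕪₂ → equal refl }) (λ _ → refl)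
Improves-update 𝕪₂ le h = related (λ { 𝕪₁ → equal refl ; 𝕪₂ → better le h }) (λ _ → refl)

occurrences⟪⟫ : Term → Term → (YVar → Bool → Bool) → YVar → Bool → Bool
occurrences⟪⟫ t₁ t₂ o i p = (not p ∧ (occT i t₁ ∨ occT i t₂)) ∨ o i p

coalition-mono : ∀ {t₁ t₂ o θ θ′} → t₁ ≢ y₂ → Related* (occurrences⟪⟫ t₁ t₂ o) θ θ′ → ⟦ t₁ ⟧ θ ≤ ⟦ t₁ ⟧ θ′
coalition-mono {y₁} t₁≢ r with onY r 𝕪₁
... | equal e     = ℕ.≤-reflexive e
... | better le _ = le
coalition-mono {y₂} t₁≢ r = contradiction refl t₁≢
coalition-mono {z k} t₁≢ r = ℕ.≤-reflexive (onZ r k)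
coalition-mono {num k} t₁≢ r = ℕ.≤-refl

opponents-mono : ∀ {t₁ t₂ o θ θ′} → t₂ ≢ y₁ → Related* (occurrences⟪⟫ t₁ t₂ o) θ θ′ → ⟦ t₂ ⟧ θ′ ≤ ⟦ t₂ ⟧ θ
opponents-mono {t₁} {y₂} {o} t₂≢ r with onY r 𝕪₂
... | equal e     = ℕ.≤-reflexive (sym e)
... | better le _ = le
-- At negative polarity the second term `y₂` is a negative occurrence, against `h`. The test of `t₁`
-- comes first and blocks computation.
... | worse _ h   = contradiction (trans (sym (Bool.∨-zeroʳ (occT 𝕪₂ t₁))) (∨-falseˡ (occT 𝕪₂ t₁ ∨ true) h)) λ ()
opponents-mono {t₂ = y₁} t₂≢ r = contradiction refl t₂≢
opponents-mono {t₂ = z k} t₂≢ r = ℕ.≤-reflexive (sym (onZ r k))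
opponents-mono {t₂ = num k} t₂≢ r = ℕ.≤-refl

-- Assignments near the limit of a prefix

Binds : Prefix → YVar → Set
Binds (one q i)    v = v ≡ i
Binds (two q i q′) v = ⊤

Polarity : Set
Polarity = YVar → Bool

-- P holds for the assignments that agree with θ outside the prefix and are close to the limit
-- values of its quantifiers, taken in order.
Near : Prefix → Polarity → Asg → (Asg → Set) → Set
Near (one q i)    π θ P = Eventually (limit q i (π i)) λ a → P (θ [ i ↦ a ])
Near (two q i q′) π θ P = Eventually (limit q i (π i)) λ a →
  Eventually (limit q′ (other i) (π (other i))) λ b → P ((θ [ i ↦ a ]) [ other i ↦ b ])

near-map : ∀ 𝒬 {π θ} {P P′ : Asg → Set} → (∀ θ′ → P θ′ → P′ θ′) → Near 𝒬 π θ P → Near 𝒬 π θ P′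
near-map (one q i)    f = ev-map λ _ → f _
near-map (two q i q′) f = ev-map λ _ → ev-map λ _ → f _

near-pure : ∀ 𝒬 {π θ} {P : Asg → Set} → (∀ θ′ → P θ′) → Near 𝒬 π θ P
near-pure (one q i)    h = ev-pure λ _ → h _
near-pure (two q i q′) h = ev-pure λ _ → ev-pure λ _ → h _

near-zip : ∀ 𝒬 {π θ} {P P′ P″ : Asg → Set} → (∀ θ′ → P θ′ → P′ θ′ → P″ θ′) →
           Near 𝒬 π θ P → Near 𝒬 π θ P′ → Near 𝒬 π θ P″
near-zip (one q i)    f = ev-zip λ _ → f _
near-zip (two q i q′) f = ev-zip λ _ → ev-zip λ _ → f _

near-dual : ∀ 𝒬 {π θ P} → Near (dualP 𝒬) (not ∘ π) θ P → Near 𝒬 π θ P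
near-dual (one q i)    {π} h rewrite limit-dual q i (π i) = h
near-dual (two q i q′) {π} h rewrite limit-dual q i (π i) | limit-dual q′ (other i) (π (other i)) = h

record AgreeOutside (𝒬 : Prefix) (θ θ′ : Asg) : Set where
  constructor outside
  field
    yv≡ : ∀ v → ¬ Binds 𝒬 v → Asg.yv θ v ≡ Asg.yv θ′ v
    zv≡ : ∀ k → Asg.zv θ k ≡ Asg.zv θ′ k

≈-update : ∀ {θ θ′} i a → (∀ v → v ≢ i → Asg.yv θ v ≡ Asg.yv θ′ v) → (∀ k → Asg.zv θ k ≡ Asg.zv θ′ k) →
           (θ [ i ↦ a ]) ≈A (θ′ [ i ↦ a ])
≈-update 𝕪₁ a e e′ = agree (λ { 𝕪₁ → refl ; 𝕪₂ → e 𝕪₂ λ () }) e′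
≈-update 𝕪₂ a e e′ = agree (λ { 𝕪₁ → e 𝕪₁ λ () ; 𝕪₂ → refl }) e′

update-update : ∀ θ i a b → (θ [ i ↦ b ]) ≈A ((θ [ i ↦ a ]) [ i ↦ b ])
update-update θ 𝕪₁ a b = agree (λ { 𝕪₁ → refl ; 𝕪₂ → refl }) λ _ → refl
update-update θ 𝕪₂ a b = agree (λ { 𝕪₁ → refl ; 𝕪₂ → refl }) λ _ → refl

update₂ : ∀ {θ θ′} i a b → (∀ k → Asg.zv θ k ≡ Asg.zv θ′ k) →
          ((θ [ i ↦ a ]) [ other i ↦ b ]) ≈A ((θ′ [ i ↦ a ]) [ other i ↦ b ])
update₂ 𝕪₁ a b e = agree (λ { 𝕪₁ → refl ; 𝕪₂ → refl }) e
update₂ 𝕪₂ a b e = agree (λ { 𝕪₁ → refl ; 𝕪₂ → refl }) e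

-- Both filters prescribe the same values for the bound variables and the rest agrees already, so
-- facts about the two bases can be compared at pointwise equal assignments.
near-meet : ∀ 𝒬 {π θ θ₁} {P P₁ : Asg → Set} {R : Set} → AgreeOutside 𝒬 θ θ₁ →
            (∀ θ′ θ₁′ → θ′ ≈A θ₁′ → P θ′ → P₁ θ₁′ → R) → Near 𝒬 π θ P → Near 𝒬 π θ₁ P₁ → R
near-meet (one q i) (outside e e′) f p p₁ =
  let a , h , h₁ = ev-∃ (ev-zip (λ _ → _,_) p p₁) in f _ _ (≈-update i a e e′) h h₁
near-meet (two q i q′) (outside e e′) f p p₁ =
  let a , p , p₁ = ev-∃ (ev-zip (λ _ → _,_) p p₁)
      b , h , h₁ = ev-∃ (ev-zip (λ _ → _,_) p p₁)
  in f _ _ (update₂ i a b e′) h h₁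

-- The alternatives that `WF` leaves for a coalition term: the variable, or a term that no update
-- changes. The equation on `isY1` lets `pushCoal` compute.
data Rigid₁ : Term → Set where
  var   : Rigid₁ y₁
  rigid : ∀ {t} → isY1 t ≡ false → (∀ θ i a → ⟦ t ⟧ (θ [ i ↦ a ]) ≡ ⟦ t ⟧ θ) → Rigid₁ t

rigid₁ : ∀ {t} → t ≢ y₂ → Rigid₁ t
rigid₁ {y₁}    t≢ = var
rigid₁ {y₂}    t≢ = contradiction refl t≢
rigid₁ {z k}   t≢ = rigid refl λ _ _ _ → refl
rigid₁ {num k} t≢ = rigid refl λ _ _ _ → refl

data Rigid₂ : Term → Set where
  var   : Rigid₂ y₂
  rigid : ∀ {t} → isY2 t ≡ false → (∀ θ i a → ⟦ t ⟧ (θ [ i ↦ a ]) ≡ ⟦ t ⟧ θ) → Rigid₂ t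

rigid₂ : ∀ {t} → t ≢ y₁ → Rigid₂ t
rigid₂ {y₁}    t≢ = contradiction refl t≢
rigid₂ {y₂}    t≢ = var
rigid₂ {z k}   t≢ = rigid refl λ _ _ _ → refl
rigid₂ {num k} t≢ = rigid refl λ _ _ _ → refl

rigid₁-value : ∀ {t} → Rigid₁ t → ∀ θ b → ⟦ t ⟧ (θ [ 𝕪₂ ↦ b ]) ≡ ⟦ t ⟧ θ
rigid₁-value var         θ b = refl
rigid₁-value (rigid _ e) θ b = e θ 𝕪₂ b

rigid₂-value : ∀ {t} → Rigid₂ t → ∀ θ a → ⟦ t ⟧ (θ [ 𝕪₁ ↦ a ]) ≡ ⟦ t ⟧ θ
rigid₂-value var         θ a = refl
rigid₂-value (rigid _ e) θ a = e θ 𝕪₁ a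

Binds-dual : ∀ 𝒬 {v} → Binds (dualP 𝒬) v → Binds 𝒬 v
Binds-dual (one q i)    b = b
Binds-dual (two q i q′) b = b

-- Well-formedness counts negations from the binder, so a newly bound variable starts at positive
-- polarity wherever its quantifier stands.
positiveAt : YVar → Polarity → Polarity
positiveAt i π v = if sameY i v then true else π v

outside-one : ∀ q i θ a → AgreeOutside (one q i) θ (θ [ i ↦ a ])
outside-one q 𝕪₁ θ a = outside (λ { 𝕪₁ n → contradiction refl n ; 𝕪₂ _ → refl }) λ _ → refl
outside-one q 𝕪₂ θ a = outside (λ { 𝕪₁ _ → refl ; 𝕪₂ n → contradiction refl n }) λ _ → refl

outside-two : ∀ {q i q′ θ θ′} → (∀ k → Asg.zv θ k ≡ Asg.zv θ′ k) → AgreeOutside (two q i q′) θ θ′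
outside-two = outside λ _ n → contradiction tt n

occurs⇒positive : ∀ p {x y} → (not p ∧ x) ∨ y ≡ false → x ≡ true → p ≡ true
occurs⇒positive true  _  _    = refl
occurs⇒positive false () refl

-- Coalition formulas

module _ {AP : Set} (M : HDMAS AP) where
  open HDMAS M

  IsDist : State → ℕ → (Act → ℕ) → Set
  IsDist u C f = sumF f ≡ C × (∀ a → d u a ≡ false → f a ≡ 0)

  Reach : (Act → ℕ) → ℕ → State → State → Set
  Reach f m u v = Σ (Dist u m) λ τ → Next u (λ a → f a + proj₁ τ a) v

  -- The one-step effectivity relation of coalition logic. Sets of states are Boolean vectors, so
  -- there are finitely many conditions and their thresholds can be combined.
  record Eff (n m : ℕ) (u : State) (A : Vec Bool nSt) : Set where
    constructor force
    field
      move   : Dist u n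
      forced : ∀ v → Reach (proj₁ move) m u v → T (lookup A v)

  open Eff

  IsDist-cong : ∀ {u C D f g} → C ≡ D → (∀ a → f a ≡ g a) → IsDist u C f → IsDist u D g
  IsDist-cong C≡D e (Σf , unav) = trans (sumF-cong (sym ∘ e)) (trans Σf C≡D) , λ a h → trans (sym (e a)) (unav a h)

  Next-cong : ∀ {u v f g} → (∀ a → f a ≡ g a) → Next u f v → Next u g v
  Next-cong {u} {v} e = subst T (evalG-cong (δ u v) (e ∘ suc))

  Reach-cong : ∀ {u v f g m n} → (∀ a → f a ≡ g a) → m ≡ n → Reach f m u v → Reach g n u v
  Reach-cong e refl (τ , h) = τ , Next-cong (λ a → cong (λ y → y + proj₁ τ a) (e a)) h

  def-IsDist : (C : PTerm k) (ts : Act → PTerm k) (u : State) → Definable (λ ρ → IsDist u (⟦ C ⟧T ρ) (λ a → ⟦ ts a ⟧T ρ))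
  def-IsDist C ts u = def-×
    (def-cong (λ ρ → subst (λ s → s ≡ ⟦ C ⟧T ρ ⇔ sumF (λ a → ⟦ ts a ⟧T ρ) ≡ ⟦ C ⟧T ρ) (sym (evalT-sum ts _)) ⇔-refl)
      (def-≡ (sumT ts) C))
    (def-∀Fin λ a → def-→ (def-const (d u a Bool.≟ false)) (def-≡ (ts a) (pconst 0)))

  def-Reach : (ts : Act → PTerm k) (m : PTerm k) (u v : State) →
              Definable (λ ρ → Reach (λ a → ⟦ ts a ⟧T ρ) (⟦ m ⟧T ρ) u v)
  def-Reach {k} ts m u v = def-cong
    (λ ρ → mk⇔ (λ (f , D , h) → (f , D) , h) (λ ((f , D) , h) → f , D , h))
    (def-∃Fun K
      (def-× (def-IsDist (weaken K m) τs u) (def-guard (δ u v) (λ i → weaken K (ts (suc i)) ⊕ τs (suc i))))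
      (λ ρ w f e →
        let τ≡ : ∀ a → ⟦ τs a ⟧T (w Vec.++ ρ) ≡ f a
            τ≡ a = trans (Vec.lookup-++ˡ w ρ a) (e a)
            sum≡ : ∀ a → ⟦ weaken K (ts a) ⊕ τs a ⟧T (w Vec.++ ρ) ≡ ⟦ ts a ⟧T ρ + f a
            sum≡ a = cong₂ _+_ (weaken-correct (ts a) w ρ) (τ≡ a)
            m≡ = weaken-correct m w ρ
        in mk⇔ (λ (D , h) → IsDist-cong m≡ τ≡ D , Next-cong sum≡ h)
               (λ (D , h) → IsDist-cong (sym m≡) (sym ∘ τ≡) D , Next-cong (sym ∘ sum≡) h)))
    where
    K = suc nAct
    τs : Act → PTerm (K + k)
    τs a = pvar (a ↑ˡ k)

  def-Eff : (n m : PTerm k) (u : State) (A : Vec Bool nSt) → Definable (λ ρ → Eff (⟦ n ⟧T ρ) (⟦ m ⟧T ρ) u A)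
  def-Eff {k} n m u A = def-cong
    (λ ρ → mk⇔ (λ (f , D , h) → force (f , D) h) (λ (force (f , D) h) → f , D , h))
    (def-∃Fun K
      (def-× (def-IsDist (weaken K n) fs u)
             (def-∀Fin λ v → def-→ (def-Reach fs (weaken K m) u v) (def-const (T? (lookup A v)))))
      (λ ρ w f e →
        let f≡ : ∀ a → ⟦ fs a ⟧T (w Vec.++ ρ) ≡ f a
            f≡ a = trans (Vec.lookup-++ˡ w ρ a) (e a)
            n≡ = weaken-correct n w ρ
            m≡ = weaken-correct m w ρ
        in mk⇔ (λ (D , h) → IsDist-cong n≡ f≡ D , λ v r → h v (Reach-cong (sym ∘ f≡) (sym m≡) r))
               (λ (D , h) → IsDist-cong (sym n≡) (sym ∘ f≡) D , λ v r → h v (Reach-cong f≡ m≡ r))))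
    where
    K = suc nAct
    fs : Act → PTerm (K + k)
    fs a = pvar (a ↑ˡ k)

  -- Abstract because unfolding the decision procedure is infeasible.
  abstract
    Reach? : ∀ f m u v → Dec (Reach f m u v)
    Reach? f m u v = def-dec (def-Reach (pconst ∘ f) (pconst m) u v) []

  Plays : Set₁
  Plays = (ℕ → State) → Set

  Coal : ℕ → ℕ → Plays → State → Set
  Coal n m L s = Σ (Strategy n) λ σ → ∀ ρ → IsPlay σ m s ρ → L ρ

  -- A strategy matters only through the successors it allows at each state. The numbers of agents
  -- enter through `E` alone, so only `E` has to be taken to a limit.
  record CoalBy (E : State → Vec Bool nSt → Set) (L : Plays) (s : State) : Set where
    constructor coalBy
    field
      target : State → Vec Bool nSt
      effect : ∀ u → E u (target u)
      wins   : ∀ ρ → ρ 0 ≡ s → (∀ k → T (lookup (target (ρ k)) (ρ (suc k)))) → L ρ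

  -- Forwards, the target at `u` is the exact set of successors possible under `σ`, so paths through
  -- the targets are plays of `σ`; `Reach?` makes this set a Boolean vector. Backwards, the forcing
  -- moves form a strategy whose plays stay within the targets.
  Coal⇔CoalBy : ∀ {n m L s} → Coal n m L s ⇔ CoalBy (Eff n m) L s
  Coal⇔CoalBy {n} {m} {L} {s} = mk⇔ forward backward
    where
    forward : Coal n m L s → CoalBy (Eff n m) L s
    forward (σ , h) = coalBy A
      (λ u → force (σ u) λ v r → subst T (sym (Vec.lookup∘tabulate _ v)) (fromWitness {a? = reach? u v} r))
      λ ρ ρ0 steps → h ρ (ρ0 , λ k → toWitness {a? = reach? (ρ k) (ρ (suc k))} (subst T (Vec.lookup∘tabulate _ (ρ (suc k))) (steps k)))
      where
      reach? : ∀ u v → Dec (Reach (proj₁ (σ u)) m u v)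
      reach? u v = Reach? (proj₁ (σ u)) m u v
      A : State → Vec Bool nSt
      A u = tabulate λ v → ⌊ reach? u v ⌋
    backward : CoalBy (Eff n m) L s → Coal n m L s
    backward (coalBy A eff h) = move ∘ eff , λ ρ (ρ0 , steps) →
      h ρ ρ0 λ k → forced (eff (ρ k)) (ρ (suc k)) (steps k)

  CoalBy-map : ∀ {E E′ L L′ s} → (∀ u A → E u A → E′ u A) → (∀ ρ → L ρ → L′ ρ) → CoalBy E L s → CoalBy E′ L′ s
  CoalBy-map e l (coalBy A eff h) = coalBy A (λ u → e u (A u) (eff u)) λ ρ ρ0 steps → l ρ (h ρ ρ0 steps)

  CoalBy-cong : ∀ {E E′ L s} → (∀ u A → E u A ⇔ E′ u A) → CoalBy E L s ⇔ CoalBy E′ L s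
  CoalBy-cong e = mk⇔ (CoalBy-map (λ u A → to (e u A)) (λ _ → id)) (CoalBy-map (λ u A → from (e u A)) (λ _ → id))

  Coal-cong : ∀ {n n′ m m′ L L′ s} → n ≡ n′ → m ≡ m′ → (∀ ρ → L ρ ⇔ L′ ρ) → Coal n m L s ⇔ Coal n′ m′ L′ s
  Coal-cong refl refl l = mk⇔ (map₂ λ h ρ p → to (l ρ) (h ρ p)) (map₂ λ h ρ p → from (l ρ) (h ρ p))

  addIdle : ∀ {u n n′} → n ≤ n′ → Dist u n → Dist u n′
  addIdle {u} {n} {n′} n≤n′ (f , Σf , unav) = g , Σg , unav′
    where
    g : Act → ℕ
    g zero    = n′ ∸ n + f zero
    g (suc i) = f (suc i)
    Σg : sumF g ≡ n′
    Σg = trans (ℕ.+-assoc (n′ ∸ n) (f zero) _) (trans (cong (λ c → n′ ∸ n + c) Σf) (ℕ.m∸n+n≡m n≤n′))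
    unav′ : ∀ a → d u a ≡ false → g a ≡ 0
    unav′ zero    ε∉ = contradiction (trans (sym (d-ε u)) ε∉) λ ()
    unav′ (suc i) = unav (suc i)

  -- Extra coalition members idle, and a response of fewer opponents is one of more opponents who
  -- idle. `Next` does not read the count of `ε`, so `nx` is reused as it is.
  Eff-mono : ∀ {n n′ m m′ u A} → n ≤ n′ → m′ ≤ m → Eff n m u A → Eff n′ m′ u A
  Eff-mono n≤ m≤ (force f h) = force (addIdle n≤ f) λ v (τ , nx) → h v (addIdle m≤ τ , nx)

  Coal-mono : ∀ {n n′ m m′ L L′ s} → n ≤ n′ → m′ ≤ m → (∀ ρ → L ρ → L′ ρ) → Coal n m L s → Coal n′ m′ L′ s
  Coal-mono n≤ m≤ l c = from Coal⇔CoalBy (CoalBy-map (λ _ _ → Eff-mono n≤ m≤) l (to Coal⇔CoalBy c))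

  -- Limits of effectivity and of coalition formulas

  EffLim : Quant → (ℕ → State → Vec Bool nSt → Set) → State → Vec Bool nSt → Set
  EffLim q E u A = Quantified q λ a → E a u A

  module _ (q : Quant) (i : YVar) (E : ℕ → State → Vec Bool nSt → Set)
           (mono : ∀ {a b u A} → Improves i a b → E a u A → E b u A)
           (definable : ∀ u A → Definable {1} (λ ρ → E (lookup ρ zero) u A)) where

    Eff-stable : Eventually (limit q i true) (λ a → ∀ u A → E a u A ⇔ EffLim q E u A)
    Eff-stable = ev-∀Fin λ u → ev-∀Vec λ A → eventually (stabilizes q i mono (definable u A))

    CoalBy-stable : ∀ {L} → Eventually (limit q i true) (λ a → ∀ s → CoalBy (E a) L s ⇔ CoalBy (EffLim q E) L s)
    CoalBy-stable = ev-map (λ a e s → CoalBy-cong e) Eff-stable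

    -- Under `∀` the targets could vary with `a`, and under `∃` each condition could have its own
    -- witness. A single `a` near the limit satisfies exactly the limit conditions, which removes
    -- both difficulties.
    CoalBy-quantified : ∀ {L s} → Quantified q (λ a → CoalBy (E a) L s) ⇔ CoalBy (EffLim q E) L s
    CoalBy-quantified {s = s} = collapse q i (λ le → CoalBy-map (λ _ _ → mono le) (λ _ → id)) (ev-map (λ a e → e s) CoalBy-stable)

  module _ (q : Quant) (i : YVar) (q′ : Quant) (j : YVar) (E : ℕ → ℕ → State → Vec Bool nSt → Set)
           (monoˡ : ∀ {a a′ b u A} → Improves i a a′ → E a b u A → E a′ b u A)
           (monoʳ : ∀ {a b b′ u A} → Improves j b b′ → E a b u A → E a b′ u A)
           (definable : ∀ {k} (x y : PTerm k) u A → Definable (λ ρ → E (⟦ x ⟧T ρ) (⟦ y ⟧T ρ) u A)) where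

    -- The limits are iterated: the threshold for `b` may depend on `a`. The outer step treats
    -- conditions already quantified over `b`, which quantifier elimination keeps definable.
    CoalBy-stable₂ : ∀ {L} → Eventually (limit q i true) λ a → Eventually (limit q′ j true) λ b →
      ∀ s → CoalBy (E a b) L s ⇔ (Quantified q λ a → Quantified q′ λ b → CoalBy (E a b) L s)
    CoalBy-stable₂ {L} = ev-map
      (λ a e → ev-map
        (λ b e′ s → ⇔-trans (e′ s) (⇔-trans (e s) (⇔-sym (⇔-trans (Quantified-cong q λ a′ → inner-q a′) outer-q))))
        (inner a))
      (CoalBy-stable q i (λ a → EffLim q′ (E a)) outer-mono definableˡ)
      where
      definableʳ : ∀ a u A → Definable {1} (λ ρ → E a (lookup ρ zero) u A)
      definableʳ a = definable (pconst a) (pvar zero)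
      definableˡ : ∀ u A → Definable {1} (λ ρ → Quantified q′ λ b → E (lookup ρ zero) b u A)
      definableˡ u A = def-Quantified q′ (definable (pvar (suc zero)) (pvar zero) u A)
      outer-mono : ∀ {a a′ u A} → Improves i a a′ → (Quantified q′ λ b → E a b u A) → (Quantified q′ λ b → E a′ b u A)
      outer-mono le = Quantified-map q′ λ b → monoˡ le
      inner : ∀ a → _
      inner a = CoalBy-stable q′ j (E a) monoʳ (definableʳ a) {L}
      inner-q : ∀ a {s} → _
      inner-q a {s} = CoalBy-quantified q′ j (E a) monoʳ (definableʳ a) {L} {s}
      outer-q : ∀ {s} → _
      outer-q {s} = CoalBy-quantified q i (λ a → EffLim q′ (E a)) outer-mono definableˡ {L} {s}

  module _ (L : Plays) where

    Coal-stable₁ : ∀ q m → Eventually (limit q 𝕪₁ true) λ a → ∀ s → Coal a m L s ⇔ Quantified q λ a → Coal a m L s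
    Coal-stable₁ q m = ev-map
      (λ a e s → ⇔-trans Coal⇔CoalBy (⇔-trans (e s) (⇔-sym (⇔-trans (Quantified-cong q λ _ → Coal⇔CoalBy)
        (CoalBy-quantified q 𝕪₁ (λ a → Eff a m) mono definable)))))
      (CoalBy-stable q 𝕪₁ (λ a → Eff a m) mono definable)
      where
      mono : ∀ {a b u A} → a ≤ b → Eff a m u A → Eff b m u A
      mono le = Eff-mono le ℕ.≤-refl
      definable = def-Eff {1} (pvar zero) (pconst m)

    Coal-stable₂ : ∀ q n → Eventually (limit q 𝕪₂ true) λ b → ∀ s → Coal n b L s ⇔ Quantified q λ b → Coal n b L s
    Coal-stable₂ q n = ev-map
      (λ a e s → ⇔-trans Coal⇔CoalBy (⇔-trans (e s) (⇔-sym (⇔-trans (Quantified-cong q λ _ → Coal⇔CoalBy)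
        (CoalBy-quantified q 𝕪₂ (Eff n) mono definable)))))
      (CoalBy-stable q 𝕪₂ (Eff n) mono definable)
      where
      mono : ∀ {a b u A} → b ≤ a → Eff n a u A → Eff n b u A
      mono = Eff-mono ℕ.≤-refl
      definable = def-Eff {1} (pconst n) (pvar zero)

    Coal-stable₁₂ : ∀ q q′ → Eventually (limit q 𝕪₁ true) λ a → Eventually (limit q′ 𝕪₂ true) λ b →
      ∀ s → Coal a b L s ⇔ Quantified q λ a → Quantified q′ λ b → Coal a b L s
    Coal-stable₁₂ q q′ = ev-map (λ a → ev-map λ b e s → ⇔-trans Coal⇔CoalBy (⇔-trans (e s)
        (⇔-sym (Quantified-cong q λ _ → Quantified-cong q′ λ _ → Coal⇔CoalBy))))
      (CoalBy-stable₂ q 𝕪₁ q′ 𝕪₂ Eff (λ le → Eff-mono le ℕ.≤-refl) (Eff-mono ℕ.≤-refl) def-Eff)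

    Coal-stable₂₁ : ∀ q q′ → Eventually (limit q 𝕪₂ true) λ b → Eventually (limit q′ 𝕪₁ true) λ a →
      ∀ s → Coal a b L s ⇔ Quantified q λ b → Quantified q′ λ a → Coal a b L s
    Coal-stable₂₁ q q′ = ev-map (λ b → ev-map λ a e s → ⇔-trans Coal⇔CoalBy (⇔-trans (e s)
        (⇔-sym (Quantified-cong q λ _ → Quantified-cong q′ λ _ → Coal⇔CoalBy))))
      (CoalBy-stable₂ q 𝕪₂ q′ 𝕪₁ (λ b a → Eff a b) (Eff-mono ℕ.≤-refl) (λ le → Eff-mono le ℕ.≤-refl) (λ x y → def-Eff y x))

  -- Monotonicity of satisfaction

  mutual
    Sat-mono : ∀ φ {θ θ′} → WF φ → Related* (λ i p → negOcc i p φ) θ θ′ → ∀ {s} → Sat M s θ φ → Sat M s θ′ φ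
    Sat-mono ⊤f       wf r h = h
    Sat-mono (prop x) wf r h = h
    Sat-mono (¬f φ)   wf r h h′ = h (Sat-mono φ wf (Related*-¬ r) h′)
    Sat-mono (φ ∧f ψ) (wf , wf′) r (h , h′) =
        Sat-mono φ wf (Related*-map (λ i p → ∨-falseˡ (negOcc i p φ)) r) h
      , Sat-mono ψ wf′ (Related*-map (λ i p → ∨-falseʳ (negOcc i p φ)) r) h′
    Sat-mono (φ ∨f ψ) (wf , wf′) r = map-⊎
      (Sat-mono φ wf (Related*-map (λ i p → ∨-falseˡ (negOcc i p φ)) r))
      (Sat-mono ψ wf′ (Related*-map (λ i p → ∨-falseʳ (negOcc i p φ)) r))
    Sat-mono (⟪ t₁ , t₂ ⟫ χ) {θ} {θ′} (t₁≢ , t₂≢ , wf) r {s} =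
      Coal-mono {L = λ ρ → SatP M ρ θ χ} {L′ = λ ρ → SatP M ρ θ′ χ} {s = s}
        (coalition-mono {t₁} {t₂} t₁≢ r) (opponents-mono {t₁} {t₂} t₂≢ r)
        (λ ρ → SatP-mono χ wf (Related*-map (λ i p → ∨-falseʳ (not p ∧ (occT i t₁ ∨ occT i t₂))) r))
    Sat-mono (Qf ∀q j φ) (_ , wf) r h n = Sat-mono φ wf (Related*-update j n r) (h n)
    Sat-mono (Qf ∃q j φ) (_ , wf) r (n , h) = n , Sat-mono φ wf (Related*-update j n r) h

    SatP-mono : ∀ χ {θ θ′} → WFP χ → Related* (λ i p → negOccP i p χ) θ θ′ → ∀ {ρ} → SatP M ρ θ χ → SatP M ρ θ′ χ
    SatP-mono (Xf φ) wf r h = Sat-mono φ wf r h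
    SatP-mono (Gf φ) wf r h k = Sat-mono φ wf r (h k)
    SatP-mono (φ Uf ψ) (wf , wf′) r (k , h , h′) = k
      , Sat-mono ψ wf′ (Related*-map (λ i p → ∨-falseʳ (negOcc i p φ)) r) h
      , λ j j<k → Sat-mono φ wf (Related*-map (λ i p → ∨-falseˡ (negOcc i p φ)) r) (h′ j j<k)

  -- Pointwise equal assignments are `Related*` whatever the occurrences are, so congruence is a
  -- case of monotonicity.
  Sat-≈ : ∀ φ {θ θ′} → WF φ → θ ≈A θ′ → ∀ {s} → Sat M s θ φ ⇔ Sat M s θ′ φ
  Sat-≈ φ wf e = mk⇔ (Sat-mono φ wf (≈⇒Related* e)) (Sat-mono φ wf (≈⇒Related* (≈-sym e)))

  SatP-≈ : ∀ χ {θ θ′} → WFP χ → θ ≈A θ′ → ∀ {ρ} → SatP M ρ θ χ ⇔ SatP M ρ θ′ χ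
  SatP-≈ χ wf e = mk⇔ (SatP-mono χ wf (≈⇒Related* e)) (SatP-mono χ wf (≈⇒Related* (≈-sym e)))

  Sat-Qf : ∀ q {i φ s θ} → Sat M s θ (Qf q i φ) ⇔ Quantified q λ a → Sat M s (θ [ i ↦ a ]) φ
  Sat-Qf ∀q = ⇔-refl
  Sat-Qf ∃q = ⇔-refl

  quantifier-limit : ∀ q i ψ θ {L : State → Set} → negOcc i true ψ ≡ false → WF ψ →
    Eventually (limit q i true) (λ a → ∀ s → Sat M s (θ [ i ↦ a ]) ψ ⇔ L s) →
    ∀ s → Sat M s θ (Qf q i ψ) ⇔ L s
  quantifier-limit q i ψ θ ¬neg wf e s = ⇔-trans (Sat-Qf q)
    (collapse q i (λ le → Sat-mono ψ wf (Improves-update i le ¬neg)) (ev-map (λ _ h → h s) e))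

  -- The semantic side of dropping a shadowed quantifier: `a` is overwritten before `ψ` is
  -- evaluated.
  quantifier-limit-shadow : ∀ q i ψ θ a {L : State → Set} → negOcc i true ψ ≡ false → WF ψ →
    Eventually (limit q i true) (λ b → ∀ s → Sat M s (θ [ i ↦ b ]) ψ ⇔ L s) →
    ∀ s → Sat M s (θ [ i ↦ a ]) (Qf q i ψ) ⇔ L s
  quantifier-limit-shadow q i ψ θ a ¬neg wf e = quantifier-limit q i ψ (θ [ i ↦ a ]) ¬neg wf
    (ev-map (λ b h s → ⇔-trans (Sat-≈ ψ wf (≈-sym (update-update θ i a b))) (h s)) e)

  Quantified⇔Qf : ∀ q {i φ s θ} {X : ℕ → Set} → (∀ a → Sat M s (θ [ i ↦ a ]) φ ⇔ X a) →
                  Quantified q X ⇔ Sat M s θ (Qf q i φ)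
  Quantified⇔Qf q e = ⇔-sym (⇔-trans (Sat-Qf q) (Quantified-cong q e))

  module _ (χ : PF AP) (θ : Asg) where

    Outcome : Plays
    Outcome ρ = SatP M ρ θ χ

    coalition-limit₁ : ∀ q {t₂} → Rigid₂ t₂ → (∀ a ρ → SatP M ρ (θ [ 𝕪₁ ↦ a ]) χ ⇔ Outcome ρ) →
      Eventually (limit q 𝕪₁ true) λ a → ∀ s →
        Coal a (⟦ t₂ ⟧ θ) Outcome s ⇔ Sat M s θ (Qf q 𝕪₁ (⟪ y₁ , t₂ ⟫ χ))
    coalition-limit₁ q r₂ ind = ev-map
      (λ a e s → ⇔-trans (e s) (Quantified⇔Qf q λ a′ → Coal-cong refl (rigid₂-value r₂ θ a′) (ind a′)))
      (Coal-stable₁ Outcome q _)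

    coalition-limit₂ : ∀ q {t₁} → Rigid₁ t₁ → (∀ b ρ → SatP M ρ (θ [ 𝕪₂ ↦ b ]) χ ⇔ Outcome ρ) →
      Eventually (limit q 𝕪₂ true) λ b → ∀ s →
        Coal (⟦ t₁ ⟧ θ) b Outcome s ⇔ Sat M s θ (Qf q 𝕪₂ (⟪ t₁ , y₂ ⟫ χ))
    coalition-limit₂ q r₁ ind = ev-map
      (λ b e s → ⇔-trans (e s) (Quantified⇔Qf q λ b′ → Coal-cong (rigid₁-value r₁ θ b′) refl (ind b′)))
      (Coal-stable₂ Outcome q _)

    Coal-≡ : ∀ {n n′ m m′ s} → n ≡ n′ → m ≡ m′ → Coal n m Outcome s ⇔ Coal n′ m′ Outcome s
    Coal-≡ p q = Coal-cong p q λ _ → ⇔-refl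

    -- Here `χ` is the goal after pushing. By the last hypothesis it does not react to the bound
    -- variables, so the quantifiers act on the numbers of agents alone. A bound variable in the
    -- terms has `π` true, which makes the limit in `Near` the one where `Coal` is stable; for other
    -- variables any value serves.
    coalition-limit : ∀ {t₁ t₂} → Rigid₁ t₁ → Rigid₂ t₂ → ∀ 𝒬 π →
      (∀ v → Binds 𝒬 v → occT v t₁ ∨ occT v t₂ ≡ true → π v ≡ true) →
      (∀ θ′ → AgreeOutside 𝒬 θ θ′ → ∀ ρ → SatP M ρ θ′ χ ⇔ Outcome ρ) →
      Near 𝒬 π θ λ θ′ → ∀ s → Coal (⟦ t₁ ⟧ θ′) (⟦ t₂ ⟧ θ′) Outcome s ⇔ Sat M s θ (pushCoal 𝒬 t₁ t₂ χ)
    coalition-limit var r₂ (one q 𝕪₁) π pos ind rewrite pos 𝕪₁ refl refl =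
      ev-map (λ a e s → ⇔-trans (Coal-≡ refl (rigid₂-value r₂ θ a)) (e s))
        (coalition-limit₁ q r₂ λ a → ind _ (outside-one q 𝕪₁ θ a))
    coalition-limit (rigid eq c) r₂ (one q 𝕪₁) π pos ind rewrite eq =
      ev-pure λ a s → Coal-≡ (c θ 𝕪₁ a) (rigid₂-value r₂ θ a)
    coalition-limit {t₁} r₁ var (one q 𝕪₂) π pos ind rewrite pos 𝕪₂ refl (Bool.∨-zeroʳ (occT 𝕪₂ t₁)) =
      ev-map (λ b e s → ⇔-trans (Coal-≡ (rigid₁-value r₁ θ b) refl) (e s))
        (coalition-limit₂ q r₁ λ b → ind _ (outside-one q 𝕪₂ θ b))
    coalition-limit r₁ (rigid eq c) (one q 𝕪₂) π pos ind rewrite eq =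
      ev-pure λ b s → Coal-≡ (rigid₁-value r₁ θ b) (c θ 𝕪₂ b)
    coalition-limit var var (two q 𝕪₁ q′) π pos ind rewrite pos 𝕪₁ tt refl | pos 𝕪₂ tt refl =
      ev-map (λ a → ev-map λ b e s → ⇔-trans (e s)
        (Quantified⇔Qf q λ _ → ⇔-sym (Quantified⇔Qf q′ λ _ → Coal-cong refl refl (ind _ (outside-two λ _ → refl)))))
        (Coal-stable₁₂ Outcome q q′)
    coalition-limit var var (two q 𝕪₂ q′) π pos ind rewrite pos 𝕪₁ tt refl | pos 𝕪₂ tt refl =
      ev-map (λ b → ev-map λ a e s → ⇔-trans (e s)
        (Quantified⇔Qf q λ _ → ⇔-sym (Quantified⇔Qf q′ λ _ → Coal-cong refl refl (ind _ (outside-two λ _ → refl)))))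
        (Coal-stable₂₁ Outcome q q′)
    coalition-limit var r₂@(rigid eq c) (two q 𝕪₁ q′) π pos ind rewrite pos 𝕪₁ tt refl | eq =
      ev-map (λ a e → ev-pure λ b s → ⇔-trans (Coal-≡ refl (trans (c _ 𝕪₂ b) (c θ 𝕪₁ a))) (e s))
        (coalition-limit₁ q r₂ λ _ → ind _ (outside-two λ _ → refl))
    coalition-limit var r₂@(rigid eq c) (two q 𝕪₂ q′) π pos ind rewrite pos 𝕪₁ tt refl | eq =
      ev-pure λ b → ev-map (λ a e s → ⇔-trans (Coal-≡ refl (trans (c _ 𝕪₁ a) (c θ 𝕪₂ b))) (e s))
        (coalition-limit₁ q′ r₂ λ _ → ind _ (outside-two λ _ → refl))
    coalition-limit {t₁} r₁@(rigid eq c) var (two q 𝕪₁ q′) π pos ind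
      rewrite pos 𝕪₂ tt (Bool.∨-zeroʳ (occT 𝕪₂ t₁)) | eq =
      ev-pure λ a → ev-map (λ b e s → ⇔-trans (Coal-≡ (trans (c _ 𝕪₂ b) (c θ 𝕪₁ a)) refl) (e s))
        (coalition-limit₂ q′ r₁ λ _ → ind _ (outside-two λ _ → refl))
    coalition-limit {t₁} r₁@(rigid eq c) var (two q 𝕪₂ q′) π pos ind
      rewrite pos 𝕪₂ tt (Bool.∨-zeroʳ (occT 𝕪₂ t₁)) | eq =
      ev-map (λ b e → ev-pure λ a s → ⇔-trans (Coal-≡ (trans (c _ 𝕪₁ a) (c θ 𝕪₂ b)) refl) (e s))
        (coalition-limit₂ q r₁ λ _ → ind _ (outside-two λ _ → refl))
    coalition-limit (rigid eq c) (rigid eq′ c′) (two q i q′) π pos ind rewrite eq | eq′ =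
      ev-pure λ a → ev-pure λ b s →
        Coal-≡ (trans (c _ (other i) b) (c θ i a)) (trans (c′ _ (other i) b) (c′ θ i a))

  -- Induction on the formula

  mutual
    -- The right-hand side stays at `θ`, so near the limit `φ` has one common truth value at each
    -- state, and this passes through all connectives.
    push-limit : ∀ 𝒬 π φ → WF φ → (∀ v → Binds 𝒬 v → negOcc v (π v) φ ≡ false) → ∀ θ →
                 Near 𝒬 π θ λ θ′ → ∀ s → Sat M s θ′ φ ⇔ Sat M s θ (push 𝒬 φ)
    push-limit 𝒬 π ⊤f       wf pos θ = near-pure 𝒬 λ _ _ → ⇔-refl
    push-limit 𝒬 π (prop x) wf pos θ = near-pure 𝒬 λ _ _ → ⇔-refl
    push-limit 𝒬 π (¬f φ)   wf pos θ = near-dual 𝒬 (near-map (dualP 𝒬) (λ _ h s → Holds-cong false (h s))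
      (push-limit (dualP 𝒬) (not ∘ π) φ wf (λ v b → pos v (Binds-dual 𝒬 b)) θ))
    push-limit 𝒬 π (φ ∧f ψ) (wf , wf′) pos θ = near-zip 𝒬 (λ _ h h′ s → h s ×-⇔ h′ s)
      (push-limit 𝒬 π φ wf (λ v b → ∨-falseˡ (negOcc v (π v) φ) (pos v b)) θ)
      (push-limit 𝒬 π ψ wf′ (λ v b → ∨-falseʳ (negOcc v (π v) φ) (pos v b)) θ)
    push-limit 𝒬 π (φ ∨f ψ) (wf , wf′) pos θ = near-zip 𝒬 (λ _ h h′ s → h s ⊎-⇔ h′ s)
      (push-limit 𝒬 π φ wf (λ v b → ∨-falseˡ (negOcc v (π v) φ) (pos v b)) θ)
      (push-limit 𝒬 π ψ wf′ (λ v b → ∨-falseʳ (negOcc v (π v) φ) (pos v b)) θ)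
    push-limit 𝒬 π (⟪ t₁ , t₂ ⟫ χ) (t₁≢ , t₂≢ , wf) pos θ = near-zip 𝒬
      (λ _ h e s → ⇔-trans (Coal-cong refl refl h) (e s))
      (pushP-limit 𝒬 π χ wf posP θ)
      (coalition-limit (pushP 𝒬 χ) θ (rigid₁ t₁≢) (rigid₂ t₂≢) 𝒬 π
        (λ v b occ → occurs⇒positive (π v) (pos v b) occ)
        -- The pushed goal at `θ₁` and at `θ` is each time equivalent to `χ` at a common near
        -- assignment, so changing bound variables does not affect it.
        (λ θ₁ out ρ → near-meet 𝒬 out
          (λ θ′ θ₁′ e h h₁ → ⇔-trans (⇔-sym (h₁ ρ)) (⇔-trans (SatP-≈ χ wf (≈-sym e)) (h ρ)))
          (pushP-limit 𝒬 π χ wf posP θ) (pushP-limit 𝒬 π χ wf posP θ₁)))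
      where
      posP : ∀ v → Binds 𝒬 v → negOccP v (π v) χ ≡ false
      posP v b = ∨-falseʳ (not (π v) ∧ (occT v t₁ ∨ occT v t₂)) (pos v b)
    push-limit (one q 𝕪₁) π (Qf q″ 𝕪₁ ψ) (¬neg , wf) pos θ = ev-pure λ a → quantifier-limit-shadow q″ 𝕪₁ ψ θ a ¬neg wf
      (push-limit (one q″ 𝕪₁) (λ _ → true) ψ wf (λ { _ refl → ¬neg }) θ)
    push-limit (one q 𝕪₂) π (Qf q″ 𝕪₂ ψ) (¬neg , wf) pos θ = ev-pure λ a → quantifier-limit-shadow q″ 𝕪₂ ψ θ a ¬neg wf
      (push-limit (one q″ 𝕪₂) (λ _ → true) ψ wf (λ { _ refl → ¬neg }) θ)
    push-limit (one q 𝕪₁) π (Qf q″ 𝕪₂ ψ) (¬neg , wf) pos θ = ev-map (λ a → quantifier-limit q″ 𝕪₂ ψ _ ¬neg wf)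
      (push-limit (two q 𝕪₁ q″) (positiveAt 𝕪₂ π) ψ wf (λ { 𝕪₁ _ → pos 𝕪₁ refl ; 𝕪₂ _ → ¬neg }) θ)
    push-limit (one q 𝕪₂) π (Qf q″ 𝕪₁ ψ) (¬neg , wf) pos θ = ev-map (λ a → quantifier-limit q″ 𝕪₁ ψ _ ¬neg wf)
      (push-limit (two q 𝕪₂ q″) (positiveAt 𝕪₁ π) ψ wf (λ { 𝕪₁ _ → ¬neg ; 𝕪₂ _ → pos 𝕪₂ refl }) θ)
    push-limit (two q 𝕪₁ q′) π (Qf q″ 𝕪₂ ψ) (¬neg , wf) pos θ = ev-map
      (λ a e → ev-pure λ b → quantifier-limit-shadow q″ 𝕪₂ ψ (θ [ 𝕪₁ ↦ a ]) b ¬neg wf e)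
      (push-limit (two q 𝕪₁ q″) (positiveAt 𝕪₂ π) ψ wf (λ { 𝕪₁ _ → pos 𝕪₁ tt ; 𝕪₂ _ → ¬neg }) θ)
    push-limit (two q 𝕪₂ q′) π (Qf q″ 𝕪₁ ψ) (¬neg , wf) pos θ = ev-map
      (λ a e → ev-pure λ b → quantifier-limit-shadow q″ 𝕪₁ ψ (θ [ 𝕪₂ ↦ a ]) b ¬neg wf e)
      (push-limit (two q 𝕪₂ q″) (positiveAt 𝕪₁ π) ψ wf (λ { 𝕪₁ _ → ¬neg ; 𝕪₂ _ → pos 𝕪₂ tt }) θ)
    -- The outer `y₁` is shadowed, so `a` is arbitrary: the new value `c` overwrites it, leaving the
    -- updates of the prefix `y₂`, `y₁`.
    push-limit (two q 𝕪₁ q′) π (Qf q″ 𝕪₁ ψ) (¬neg , wf) pos θ = ev-pure λ a → ev-map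
      (λ b e → quantifier-limit q″ 𝕪₁ ψ _ ¬neg wf
        (ev-map (λ c h s → ⇔-trans (Sat-≈ ψ wf (agree (λ { 𝕪₁ → refl ; 𝕪₂ → refl }) λ _ → refl)) (h s)) e))
      (push-limit (two q′ 𝕪₂ q″) (positiveAt 𝕪₁ π) ψ wf (λ { 𝕪₁ _ → ¬neg ; 𝕪₂ _ → pos 𝕪₂ tt }) θ)
    push-limit (two q 𝕪₂ q′) π (Qf q″ 𝕪₂ ψ) (¬neg , wf) pos θ = ev-pure λ a → ev-map
      (λ b e → quantifier-limit q″ 𝕪₂ ψ _ ¬neg wf
        (ev-map (λ c h s → ⇔-trans (Sat-≈ ψ wf (agree (λ { 𝕪₁ → refl ; 𝕪₂ → refl }) λ _ → refl)) (h s)) e))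
      (push-limit (two q′ 𝕪₁ q″) (positiveAt 𝕪₂ π) ψ wf (λ { 𝕪₁ _ → pos 𝕪₁ tt ; 𝕪₂ _ → ¬neg }) θ)

    pushP-limit : ∀ 𝒬 π χ → WFP χ → (∀ v → Binds 𝒬 v → negOccP v (π v) χ ≡ false) → ∀ θ →
                  Near 𝒬 π θ λ θ′ → ∀ ρ → SatP M ρ θ′ χ ⇔ SatP M ρ θ (pushP 𝒬 χ)
    pushP-limit 𝒬 π (Xf φ) wf pos θ = near-map 𝒬 (λ _ h ρ → h (ρ 1)) (push-limit 𝒬 π φ wf pos θ)
    pushP-limit 𝒬 π (Gf φ) wf pos θ = near-map 𝒬
      (λ _ h ρ → mk⇔ (λ g k → to (h (ρ k)) (g k)) (λ g k → from (h (ρ k)) (g k)))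
      (push-limit 𝒬 π φ wf pos θ)
    pushP-limit 𝒬 π (φ Uf ψ) (wf , wf′) pos θ = near-zip 𝒬
      (λ _ h h′ ρ → mk⇔ (λ (k , g′ , g) → k , to (h′ (ρ k)) g′ , λ j j<k → to (h (ρ j)) (g j j<k))
                        (λ (k , g′ , g) → k , from (h′ (ρ k)) g′ , λ j j<k → from (h (ρ j)) (g j j<k)))
      (push-limit 𝒬 π φ wf (λ v b → ∨-falseˡ (negOcc v (π v) φ) (pos v b)) θ)
      (push-limit 𝒬 π ψ wf′ (λ v b → ∨-falseʳ (negOcc v (π v) φ) (pos v b)) θ)

theorem1 : {AP : Set} (𝒬 : Prefix) (φ : SF AP) → WF (applyP 𝒬 φ) →
    (M : HDMAS AP) (s : HDMAS.State M) (θ : Asg) →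
    Sat M s θ (push 𝒬 φ) ⇔ Sat M s θ (applyP 𝒬 φ)
theorem1 (one q i) φ (¬neg , wf) M s θ = ⇔-sym (quantifier-limit M q i φ θ ¬neg wf
  (push-limit M (one q i) (λ _ → true) φ wf (λ { _ refl → ¬neg }) θ) s)
theorem1 (two q i q′) φ wf@(¬neg , ¬neg′ , wfφ) M s θ = ⇔-sym (quantifier-limit M q i (Qf q′ (other i) φ) θ ¬neg (proj₂ wf)
  (ev-map (λ a → quantifier-limit M q′ (other i) φ (θ [ i ↦ a ]) ¬neg′ wfφ)
    (push-limit M (two q i q′) (λ _ → true) φ wfφ (λ v _ → bothPositive i v ¬neg ¬neg′) θ)) s)
  where
  -- Only for a concrete `i` does `sameY` compute, exposing positivity of `y_i` in `φ` below the
  -- inner quantifier.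
  bothPositive : ∀ i v → negOcc i true (Qf q′ (other i) φ) ≡ false → negOcc (other i) true φ ≡ false →
                 negOcc v true φ ≡ false
  bothPositive 𝕪₁ 𝕪₁ h h′ = h
  bothPositive 𝕪₁ 𝕪₂ h h′ = h′
  bothPositive 𝕪₂ 𝕪₁ h h′ = h′
  bothPositive 𝕪₂ 𝕪₂ h h′ = h
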